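{- Let $f=a_dX^d+\cdots+a_1X+a_0\in\mathbb{Z}[X]$ be an irreducible polynomial of degree $d\ge 2$ and height $H$, and let $M$ be the product of all distinct prime divisors of the discriminant of $f$. Then there exists a prime number $$ p\le\begin{cases} H, & \text{if } \gcd(a_0,M)=1 \text{ and } |a_0|>1,\\ 2H(dM)^d, & \text{if } |a_0|=1,\\ 2H(dHM)^d, & \text{if } \gcd(a_0,M)>1,\end{cases} $$ such that $f$ has a simple root modulo $p$.
   Context: The height of $f$ is $H=\max_i|a_i|$. "$f$ has a simple root modulo $p$" means there is an integer $a$ that is a root of multiplicity one of the reduction of $f$ modulo $p$, i.e. $f(a)\equiv 0\pmod p$ and $f'(a)\not\equiv0\pmod p$. -}

module Defs where

open import Data.Nat as ℕ using (ℕ; zero; suc; _⊔_; _≤_; _<_)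
open import Data.Nat.Divisibility as ℕD using (_∣?_)
open import Data.Nat.Primality using (Prime; prime?)
open import Data.Integer as ℤ using (ℤ; +_; -[1+_]; +[1+_]; 0ℤ; 1ℤ; -1ℤ; ∣_∣)
open import Data.Integer.DivMod using () renaming (_/_ to _divℤ_)
open import Data.Integer.Divisibility using () renaming (_∣_ to _∣ℤ_)
open import Data.Fin using (Fin; toℕ; punchIn) renaming (zero to fzero; suc to fsuc)
open import Data.List using (List; []; _∷_; foldr; length; filter; upTo)
open import Data.Nat.ListAction using (product)
open import Data.Product using (Σ; _×_; _,_; ∃)
open import Data.Sum using (_⊎_)
open import Relation.Nullary using (¬_; does)
open import Relation.Nullary.Decidable using (_×-dec_)
open import Relation.Binary.PropositionalEquality using (_≡_)
open import Data.Bool using (if_then_else_)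

-- Polynomials in ℤ[X] are coefficient lists, lowest degree first:
-- [a₀, a₁, …, a_d] represents a₀ + a₁X + … + a_dX^d.
Poly : Set
Poly = List ℤ

coeff : Poly → ℕ → ℤ
coeff []       _       = 0ℤ
coeff (a ∷ _)  zero    = a
coeff (_ ∷ as) (suc k) = coeff as k

-- equality of polynomials (coefficientwise, so trailing zeros are irrelevant)
_≈ₚ_ : Poly → Poly → Set
p ≈ₚ q = ∀ k → coeff p k ≡ coeff q k

_+ₚ_ : Poly → Poly → Poly
[]       +ₚ q        = q
(a ∷ p)  +ₚ []       = a ∷ p
(a ∷ p)  +ₚ (b ∷ q)  = (a ℤ.+ b) ∷ (p +ₚ q)

scale : ℤ → Poly → Poly
scale c []       = []
scale c (a ∷ p)  = (c ℤ.* a) ∷ scale c p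

_*ₚ_ : Poly → Poly → Poly
[]      *ₚ q = []
(a ∷ p) *ₚ q = scale a q +ₚ (0ℤ ∷ (p *ₚ q))

IsUnit : Poly → Set
IsUnit g = (g ≈ₚ (1ℤ ∷ [])) ⊎ (g ≈ₚ (-1ℤ ∷ []))

Irreducible : Poly → Set
Irreducible f = ¬ (f ≈ₚ []) × ¬ IsUnit f ×
  (∀ g h → f ≈ₚ (g *ₚ h) → IsUnit g ⊎ IsUnit h)

eval : Poly → ℤ → ℤ
eval f x = foldr (λ a acc → a ℤ.+ x ℤ.* acc) 0ℤ f

derivAux : ℕ → Poly → Poly
derivAux k []       = []
derivAux k (a ∷ as) = (+ k ℤ.* a) ∷ derivAux (suc k) as

deriv : Poly → Poly
deriv []       = []
deriv (_ ∷ as) = derivAux 1 as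

height : Poly → ℕ
height f = foldr (λ a m → ∣ a ∣ ⊔ m) 0 f

SimpleRootMod : Poly → ℕ → Set
SimpleRootMod f p = ∃ λ (a : ℤ) → ((+ p) ∣ℤ eval f a) × ¬ ((+ p) ∣ℤ eval (deriv f) a)

sumFin : (n : ℕ) → (Fin n → ℤ) → ℤ
sumFin zero    g = 0ℤ
sumFin (suc n) g = g fzero ℤ.+ sumFin n (λ j → g (fsuc j))

altSign : ℕ → ℤ
altSign zero          = 1ℤ
altSign (suc zero)    = -1ℤ
altSign (suc (suc k)) = altSign k

det : (n : ℕ) → (Fin n → Fin n → ℤ) → ℤ
det zero    A = 1ℤ
det (suc n) A = sumFin (suc n) (λ j →
  altSign (toℕ j) ℤ.* A fzero j ℤ.* det n (λ r c → A (fsuc r) (punchIn j c)))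

-- entry of a Sylvester row: polynomial p of degree deg, coefficients written
-- from highest to lowest starting at column `shift`
band : ℕ → Poly → ℕ → ℕ → ℤ
band deg p shift col =
  if does (shift ℕ.≤? col) then
    (if does ((col ℕ.∸ shift) ℕ.≤? deg) then coeff p (deg ℕ.∸ (col ℕ.∸ shift)) else 0ℤ)
  else 0ℤ

sylvester : (m n : ℕ) → Poly → Poly → Fin (m ℕ.+ n) → Fin (m ℕ.+ n) → ℤ
sylvester m n f g i j =
  if does (toℕ i ℕ.<? n) then band m f (toℕ i) (toℕ j)
  else band n g (toℕ i ℕ.∸ n) (toℕ j)

resultant : (m n : ℕ) → Poly → Poly → ℤ
resultant m n f g = det (m ℕ.+ n) (sylvester m n f g)

-- integer division (used only for the exact division by the leading coefficient)
exactDiv : ℤ → ℤ → ℤ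
exactDiv r (+ zero)      = 0ℤ
exactDiv r d@(+[1+ _ ])  = r divℤ d
exactDiv r d@(-[1+ _ ])  = r divℤ d

-- degree of a coefficient list (assumed to have nonzero last entry)
deg : Poly → ℕ
deg f = length f ℕ.∸ 1

disc : Poly → ℤ
disc f = altSign ((deg f ℕ.* (deg f ℕ.∸ 1)) ℕ./ 2) ℤ.*
         exactDiv (resultant (deg f) (deg f ℕ.∸ 1) f (deriv f)) (coeff f (deg f))

radical : ℕ → ℕ
radical n = product (filter (λ q → prime? q ×-dec (q ∣? n)) (upTo (suc n)))

{-# OPTIONS --safe #-}

-- Writing f = a₀ + X h, one has f(a₀ x) = a₀ V(x) with V(x) = 1 + x h(a₀ x). If M divides x, then V(x) is
-- coprime to M, so a prime p dividing V(x) does not divide the discriminant, and a₀ x is a simple root of f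
-- modulo p. Some multiple x = k M with |k| ≤ d has |V(x)| ≠ 1, since otherwise f − a₀ and f + a₀
-- would have 2d + 1 roots in total. If gcd(a₀, M) = 1 and |a₀| > 1, a prime divisor of a₀ works, with root 0.
--
-- Two facts about the discriminant are needed. A prime dividing both f(t) and f′(t) divides it: Horner's
-- rule on the columns of the Sylvester matrix makes the last column consist of multiples of f(t) and
-- f′(t), while the first column is divisible by the leading coefficient. And it is nonzero: a vanishing
-- resultant gives u f + v f′ = 0 with deg v < d and (u, v) ≠ 0, which the Euclidean algorithm and
-- Gauss's lemma turn into a proper factorisation of f.
module Submission where

open import Defs
open import Data.Nat as ℕ using (ℕ; zero; suc; s≤s; z≤n)
import Data.Nat.Properties as ℕ
import Data.Nat.Divisibility as ℕ
open import Data.Nat.GCD using (gcd; gcd-greatest)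
open import Data.Nat.Primality using (Prime)
import Data.Nat.Tactic.RingSolver as ℕ-Solver
open import Data.Integer using (ℤ; 0ℤ; ∣_∣)
open import Data.Integer.Tactic.RingSolver using (solve-∀)
open import Data.Fin using (Fin; toℕ; punchIn) renaming (zero to fzero; suc to fsuc)
open import Data.List using (List; []; _∷_; _++_; length; tabulate; applyUpTo)
open import Data.List.Properties using (++-assoc; ++-identityʳ; length-++; length-applyUpTo; length-replicate)
open import Data.List.Relation.Unary.All as All using (All; []; _∷_)
open import Data.List.Relation.Unary.AllPairs using ([]; _∷_)
open import Data.List.Relation.Unary.Unique.Propositional using (Unique)
open import Data.List.Relation.Unary.Unique.Propositional.Properties using (applyUpTo⁺₁)
open import Data.Vec using (Vec; []; _∷_)
open import Data.Vec.Relation.Unary.Any using (Any; here; there)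
open import Data.Product using (_×_; _,_; ∃; ∃₂; proj₁; proj₂)
open import Data.Sum as Sum using (_⊎_; inj₁; inj₂; [_,_]′)
open import Function using (_∘_)
open import Relation.Nullary using (¬_; Dec; does; yes; no; contradiction)
open import Relation.Binary.PropositionalEquality using (_≡_; _≢_; refl; sym; trans; cong; cong₂; subst; subst₂; module ≡-Reasoning)

-- The discriminant is the resultant divided by the leading coefficient, and `p` may divide that
-- coefficient. So it is not enough that `p` divides the resultant: the product of both must divide
-- it, which is why the two factors are pulled out of two different columns, the first and the last.
-- The discriminant must be nonzero because `radical 0` is the empty product 1: with a vanishing
-- discriminant, being coprime to `M` would exclude no prime at all. All arguments stay in ℤ.
-- Elimination, pseudo-division and the Euclidean descent multiply by nonzero integers where a field
-- would allow division, so only vanishing and nonvanishing are carried along, and the accumulated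
-- constant is removed once, by Gauss's lemma. The determinant of the statement expands along rows
-- of a matrix given as a function, which suits column operations badly; hence the detour through
-- lists of columns.

module Determinants where
  open import Data.Integer using (1ℤ; _+_; _-_; _*_; -_; _≟_)
  open import Data.Integer.Properties using (*-zeroʳ; +-identityʳ; +-identityˡ; i*j≡0⇒i≡0∨j≡0)
  open import Data.Vec using (map; replicate)
  import Data.Vec.Relation.Unary.Any as Any
  import Data.Vec.Relation.Unary.Any.Properties as Any
  open ≡-Reasoning

  *-cancel-0 : ∀ {a b} → a ≢ 0ℤ → a * b ≡ 0ℤ → b ≡ 0ℤ
  *-cancel-0 {a} a≢0 ab≡0 with i*j≡0⇒i≡0∨j≡0 a ab≡0
  ... | inj₁ a≡0 = contradiction a≡0 a≢0
  ... | inj₂ b≡0 = b≡0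

  -- Determinants as multilinear alternating functions of column lists.

  Column : Set
  Column = ℕ → ℤ

  -- D n cs is the determinant of the n × n matrix with columns cs, expanded along its top row, where
  -- rows are numbered from the bottom: the minors then keep the columns unchanged. It is 0 when
  -- length cs ≢ n, so that multilinearity needs no hypothesis on lengths.
  mutual
    D : ℕ → List Column → ℤ
    D zero    []      = 1ℤ
    D zero    (_ ∷ _) = 0ℤ
    D (suc n) cs      = expand n [] cs

    expand : ℕ → List Column → List Column → ℤ
    expand n pre []         = 0ℤ
    expand n pre (c ∷ post) = c n * D n (pre ++ post) - expand n (pre ++ c ∷ []) post

  D-zero-∷ : ∀ xs {w ys} → D zero (xs ++ w ∷ ys) ≡ 0ℤ
  D-zero-∷ []       = refl
  D-zero-∷ (_ ∷ xs) = refl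

  module _ (α β : ℤ) {w u v : Column} where
    private
      Combination : ℕ → Set
      Combination n = ∀ i → i ℕ.< n → w i ≡ α * u i + β * v i

      null : 0ℤ ≡ α * 0ℤ + β * 0ℤ
      null = vanish α β
        where
        vanish : ∀ α β → 0ℤ ≡ α * 0ℤ + β * 0ℤ
        vanish = solve-∀

      regroup : ∀ a {X X₁ X₂ Y Y₁ Y₂} → X ≡ α * X₁ + β * X₂ → Y ≡ α * Y₁ + β * Y₂ →
        a * X - Y ≡ α * (a * X₁ - Y₁) + β * (a * X₂ - Y₂)
      regroup a {X₁ = X₁} {X₂} {Y₁ = Y₁} {Y₂} X≡ Y≡ =
        trans (cong₂ (λ X Y → a * X - Y) X≡ Y≡) (distribute a α β X₁ X₂ Y₁ Y₂)
        where
        distribute : ∀ a α β X₁ X₂ Y₁ Y₂ →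
          a * (α * X₁ + β * X₂) - (α * Y₁ + β * Y₂) ≡ α * (a * X₁ - Y₁) + β * (a * X₂ - Y₂)
        distribute = solve-∀

      regroup′ : ∀ X {a a₁ a₂ Y Y₁ Y₂} → a ≡ α * a₁ + β * a₂ → Y ≡ α * Y₁ + β * Y₂ →
        a * X - Y ≡ α * (a₁ * X - Y₁) + β * (a₂ * X - Y₂)
      regroup′ X {a₁ = a₁} {a₂} {Y₁ = Y₁} {Y₂} a≡ Y≡ =
        trans (cong₂ (λ a Y → a * X - Y) a≡ Y≡) (distribute X α β a₁ a₂ Y₁ Y₂)
        where
        distribute : ∀ X α β a₁ a₂ Y₁ Y₂ →
          (α * a₁ + β * a₂) * X - (α * Y₁ + β * Y₂) ≡ α * (a₁ * X - Y₁) + β * (a₂ * X - Y₂)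
        distribute = solve-∀

    mutual
      -- During the expansion the marked column lies either among those still to come or among those
      -- already passed, hence two companion lemmas. When it is itself the expanded column, its top
      -- entry is a linear combination and the common minor no longer contains it; every later minor
      -- does.
      D-linear : ∀ n → Combination n → ∀ xs ys →
        D n (xs ++ w ∷ ys) ≡ α * D n (xs ++ u ∷ ys) + β * D n (xs ++ v ∷ ys)
      D-linear zero lin xs ys
        rewrite D-zero-∷ xs {w} {ys} | D-zero-∷ xs {u} {ys} | D-zero-∷ xs {v} {ys} = null
      D-linear (suc n) lin xs ys = expand-linearʳ n lin [] xs ys

      expand-linearʳ : ∀ n → Combination (suc n) → ∀ pre xs ys →
        expand n pre (xs ++ w ∷ ys) ≡ α * expand n pre (xs ++ u ∷ ys) + β * expand n pre (xs ++ v ∷ ys)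
      expand-linearʳ n lin pre [] ys =
        regroup′ (D n (pre ++ ys)) (lin n ℕ.≤-refl) (expand-linearˡ n lin pre [] ys)
      expand-linearʳ n lin pre (x ∷ xs) ys =
        regroup (x n) minors (expand-linearʳ n lin (pre ++ x ∷ []) xs ys)
        where
        minors : D n (pre ++ xs ++ w ∷ ys) ≡ α * D n (pre ++ xs ++ u ∷ ys) + β * D n (pre ++ xs ++ v ∷ ys)
        minors rewrite sym (++-assoc pre xs (w ∷ ys)) | sym (++-assoc pre xs (u ∷ ys))
                     | sym (++-assoc pre xs (v ∷ ys)) = D-linear n (λ i i<n → lin i (ℕ.m<n⇒m<1+n i<n)) (pre ++ xs) ys

      expand-linearˡ : ∀ n → Combination (suc n) → ∀ xs ys post →
        expand n (xs ++ w ∷ ys) post ≡ α * expand n (xs ++ u ∷ ys) post + β * expand n (xs ++ v ∷ ys) post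
      expand-linearˡ n lin xs ys [] = null
      expand-linearˡ n lin xs ys (c ∷ post)
        rewrite ++-assoc xs (w ∷ ys) post | ++-assoc xs (u ∷ ys) post | ++-assoc xs (v ∷ ys) post
              | ++-assoc xs (w ∷ ys) (c ∷ []) | ++-assoc xs (u ∷ ys) (c ∷ []) | ++-assoc xs (v ∷ ys) (c ∷ []) =
        regroup (c n) (D-linear n (λ i i<n → lin i (ℕ.m<n⇒m<1+n i<n)) xs (ys ++ post))
          (expand-linearˡ n lin xs (ys ++ c ∷ []) post)

  private
    cancel : ∀ a {X Y} → X ≡ 0ℤ → Y ≡ 0ℤ → a * X - Y ≡ 0ℤ
    cancel a refl refl = vanish a
      where
      vanish : ∀ a → a * 0ℤ - 0ℤ ≡ 0ℤ
      vanish = solve-∀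

  mutual
    -- The two terms that remove one of the equal columns share their minor and have opposite signs;
    -- every other minor still contains both columns side by side.
    D-adjacent-equal : ∀ n u xs ys → D n (xs ++ u ∷ u ∷ ys) ≡ 0ℤ
    D-adjacent-equal zero    u xs ys = D-zero-∷ xs
    D-adjacent-equal (suc n) u xs ys = expand-adjacent-equalʳ n u [] xs ys

    expand-adjacent-equalʳ : ∀ n u pre xs ys → expand n pre (xs ++ u ∷ u ∷ ys) ≡ 0ℤ
    expand-adjacent-equalʳ n u pre [] ys
      rewrite ++-assoc pre (u ∷ []) ys | ++-assoc pre (u ∷ []) (u ∷ [])
            | expand-adjacent-equalˡ n u pre [] ys = twice (u n * D n (pre ++ u ∷ ys))
      where
      twice : ∀ X → X - (X - 0ℤ) ≡ 0ℤ
      twice = solve-∀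
    expand-adjacent-equalʳ n u pre (x ∷ xs) ys
      rewrite sym (++-assoc pre xs (u ∷ u ∷ ys)) =
      cancel (x n) (D-adjacent-equal n u (pre ++ xs) ys) (expand-adjacent-equalʳ n u (pre ++ x ∷ []) xs ys)

    expand-adjacent-equalˡ : ∀ n u xs ys post → expand n (xs ++ u ∷ u ∷ ys) post ≡ 0ℤ
    expand-adjacent-equalˡ n u xs ys [] = refl
    expand-adjacent-equalˡ n u xs ys (c ∷ post)
      rewrite ++-assoc xs (u ∷ u ∷ ys) post | ++-assoc xs (u ∷ u ∷ ys) (c ∷ []) =
      cancel (c n) (D-adjacent-equal n u xs (ys ++ post)) (expand-adjacent-equalˡ n u xs (ys ++ c ∷ []) post)

  D-scale : ∀ n a {w u} xs ys → (∀ i → i ℕ.< n → w i ≡ a * u i) →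
    D n (xs ++ w ∷ ys) ≡ a * D n (xs ++ u ∷ ys)
  D-scale n a {w} {u} xs ys w≡au =
    trans (D-linear a 0ℤ {v = u} n (λ i i<n → trans (w≡au i i<n) (absorb (a * u i) (u i))) xs ys)
          (sym (absorb _ (D n (xs ++ u ∷ ys))))
    where
    absorb : ∀ X Y → X ≡ X + 0ℤ * Y
    absorb = solve-∀

  combine : ℤ → Column → ℤ → Column → Column
  combine α u β v i = α * u i + β * v i

  -- The share of `u` creates two equal neighbours and vanishes. Elimination and Horner's rule only
  -- ever combine neighbouring columns, so repeated columns further apart need not be considered.
  D-combine-next : ∀ n α β u v xs ys →
    D n (xs ++ u ∷ combine α v β u ∷ ys) ≡ α * D n (xs ++ u ∷ v ∷ ys)
  D-combine-next n α β u v xs ys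
    with lin ← D-linear α β {combine α v β u} n (λ _ _ → refl) (xs ++ u ∷ []) ys
    rewrite ++-assoc xs (u ∷ []) (combine α v β u ∷ ys) | ++-assoc xs (u ∷ []) (v ∷ ys)
          | ++-assoc xs (u ∷ []) (u ∷ ys) | D-adjacent-equal n u xs ys | *-zeroʳ β =
    trans lin (+-identityʳ _)

  -- Polarisation: two neighbours both equal to `u + v` give 0, and of the four terms only the mixed
  -- ones survive.
  D-swap : ∀ n u v xs ys → D n (xs ++ v ∷ u ∷ ys) ≡ - D n (xs ++ u ∷ v ∷ ys)
  D-swap n u v xs ys = solveFor (begin
    0ℤ
      ≡⟨ D-adjacent-equal n s xs ys ⟨
    D n (xs ++ s ∷ s ∷ ys)
      ≡⟨ D-linear 1ℤ 1ℤ n (λ _ _ → refl) xs (s ∷ ys) ⟩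
    1ℤ * D n (xs ++ u ∷ s ∷ ys) + 1ℤ * D n (xs ++ v ∷ s ∷ ys)
      ≡⟨ cong₂ (λ X Y → 1ℤ * X + 1ℤ * Y) (second u) (second v) ⟩
    1ℤ * (1ℤ * D n (xs ++ u ∷ u ∷ ys) + 1ℤ * D n (xs ++ u ∷ v ∷ ys)) +
    1ℤ * (1ℤ * D n (xs ++ v ∷ u ∷ ys) + 1ℤ * D n (xs ++ v ∷ v ∷ ys))
      ≡⟨ cong₂ (λ X Y → 1ℤ * (1ℤ * X + 1ℤ * D n (xs ++ u ∷ v ∷ ys)) + 1ℤ * (1ℤ * D n (xs ++ v ∷ u ∷ ys) + 1ℤ * Y))
               (D-adjacent-equal n u xs ys) (D-adjacent-equal n v xs ys) ⟩
    1ℤ * (1ℤ * 0ℤ + 1ℤ * D n (xs ++ u ∷ v ∷ ys)) + 1ℤ * (1ℤ * D n (xs ++ v ∷ u ∷ ys) + 1ℤ * 0ℤ) ∎)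
    where
    s : Column
    s = combine 1ℤ u 1ℤ v

    second : ∀ x → D n (xs ++ x ∷ s ∷ ys) ≡ 1ℤ * D n (xs ++ x ∷ u ∷ ys) + 1ℤ * D n (xs ++ x ∷ v ∷ ys)
    second x with lin ← D-linear 1ℤ 1ℤ {s} {u} {v} n (λ _ _ → refl) (xs ++ x ∷ []) ys
      rewrite ++-assoc xs (x ∷ []) (s ∷ ys) | ++-assoc xs (x ∷ []) (u ∷ ys)
            | ++-assoc xs (x ∷ []) (v ∷ ys) = lin

    isolate : ∀ X Y → Y ≡ 1ℤ * (1ℤ * 0ℤ + 1ℤ * X) + 1ℤ * (1ℤ * Y + 1ℤ * 0ℤ) - X
    isolate = solve-∀

    solveFor : ∀ {X Y} → 0ℤ ≡ 1ℤ * (1ℤ * 0ℤ + 1ℤ * X) + 1ℤ * (1ℤ * Y + 1ℤ * 0ℤ) → Y ≡ - X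
    solveFor {X} {Y} eq = trans (isolate X Y) (trans (cong (_- X) (sym eq)) (+-identityˡ (- X)))

  -- The head of the vector belongs to the top row, which has the largest index.
  dot : ∀ {n} → Vec ℤ n → Column → ℤ
  dot []               c = 0ℤ
  dot {suc n} (x ∷ xs) c = x * c n + dot xs c

  dot-cong : ∀ {n} (x : Vec ℤ n) {c c′} → (∀ i → i ℕ.< n → c i ≡ c′ i) → dot x c ≡ dot x c′
  dot-cong []       eq = refl
  dot-cong {suc n} (x ∷ xs) eq =
    cong₂ (λ X Y → x * X + Y) (eq n ℕ.≤-refl) (dot-cong xs (λ i i<n → eq i (ℕ.m<n⇒m<1+n i<n)))

  dot-combine : ∀ {n} (x : Vec ℤ n) α u β v → dot x (combine α u β v) ≡ α * dot x u + β * dot x v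
  dot-combine [] α u β v = vanish α β
    where
    vanish : ∀ α β → 0ℤ ≡ α * 0ℤ + β * 0ℤ
    vanish = solve-∀
  dot-combine {suc n} (x ∷ xs) α u β v =
    trans (cong (λ X → x * (α * u n + β * v n) + X) (dot-combine xs α u β v))
          (regroup x α β (u n) (v n) (dot xs u) (dot xs v))
    where
    regroup : ∀ x α β a b X Y → x * (α * a + β * b) + (α * X + β * Y) ≡ α * (x * a + X) + β * (x * b + Y)
    regroup = solve-∀

  dot-scale : ∀ {n} a (x : Vec ℤ n) c → dot (map (a *_) x) c ≡ a * dot x c
  dot-scale a []       c = sym (*-zeroʳ a)
  dot-scale {suc n} a (x ∷ xs) c =
    trans (cong (λ X → a * x * c n + X) (dot-scale a xs c)) (factor a x (c n) (dot xs c))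
    where
    factor : ∀ a x y X → a * x * y + a * X ≡ a * (x * y + X)
    factor = solve-∀

  dot-0 : ∀ n c → dot (replicate n 0ℤ) c ≡ 0ℤ
  dot-0 zero    c = refl
  dot-0 (suc n) c = trans (+-identityˡ _) (dot-0 n c)

  -- Elimination and left kernel vectors of singular integer matrices.

  Kills : ∀ {n} → Vec ℤ n → List Column → Set
  Kills x = All (λ c → dot x c ≡ 0ℤ)

  -- Column elimination of the top row, which has index `n`. Without division the determinant gets
  -- multiplied by integers, so only its vanishing is passed forward, while kernel vectors are
  -- passed back to the original columns. The prefix `pre` lets the reduction of a tail be used
  -- inside a longer list.
  record Reduction (n : ℕ) (c : Column) (cs : List Column) : Set where
    field
      pivot     : Column
      rest      : List Column
      length-eq : length rest ≡ length cs
      cleared   : All (λ r → r n ≡ 0ℤ) rest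
      singular  : ∀ pre → D (suc n) (pre ++ c ∷ cs) ≡ 0ℤ → D (suc n) (pre ++ pivot ∷ rest) ≡ 0ℤ
      kernel    : (x : Vec ℤ (suc n)) → Kills x (pivot ∷ rest) → Kills x (c ∷ cs)

  -- The tail is reduced first, after which its pivot `g` is the only tail column that may have a
  -- nonzero top entry. It remains to settle the neighbours `c` and `g`.
  reduce : ∀ n c cs → Reduction n c cs
  reduce n c [] = record
    { pivot = c ; rest = [] ; length-eq = refl ; cleared = []
    ; singular = λ _ eq → eq ; kernel = λ _ k → k }
  reduce n c (c′ ∷ cs) with reduce n c′ cs
  ... | record { pivot = g ; rest = gs ; length-eq = len ; cleared = zeros ; singular = sing ; kernel = ker } = go
    where
    shifted : ∀ pre → D (suc n) (pre ++ c ∷ c′ ∷ cs) ≡ 0ℤ → D (suc n) (pre ++ c ∷ g ∷ gs) ≡ 0ℤ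
    shifted pre eq with out ← sing (pre ++ c ∷ [])
      rewrite ++-assoc pre (c ∷ []) (c′ ∷ cs) | ++-assoc pre (c ∷ []) (g ∷ gs) = out eq

    go : Reduction n c (c′ ∷ cs)
    go with g n ≟ 0ℤ | c n ≟ 0ℤ
    ... | yes gn≡0 | _ = record
      { pivot = c ; rest = g ∷ gs ; length-eq = cong suc len ; cleared = gn≡0 ∷ zeros
      ; singular = shifted ; kernel = λ { x (k ∷ ks) → k ∷ ker x ks } }
    -- Here the combination of the last case would multiply `g` by `c n = 0` and lose it, so the two
    -- columns are swapped instead.
    ... | no gn≢0 | yes cn≡0 = record
      { pivot = g ; rest = c ∷ gs ; length-eq = cong suc len ; cleared = cn≡0 ∷ zeros
      ; singular = λ pre eq → trans (D-swap (suc n) c g pre gs) (cong -_ (shifted pre eq))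
      ; kernel = λ { x (k ∷ k′ ∷ ks) → k′ ∷ ker x (k ∷ ks) } }
    ... | no gn≢0 | no cn≢0 = record
      { pivot = c ; rest = combine (c n) g (- g n) c ∷ gs ; length-eq = cong suc len
      ; cleared = vanish (c n) (g n) ∷ zeros
      ; singular = λ pre eq → trans (D-combine-next (suc n) (c n) (- g n) c g pre gs)
          (trans (cong (c n *_) (shifted pre eq)) (*-zeroʳ (c n)))
      ; kernel = λ { x (k ∷ k′ ∷ ks) → k ∷ ker x (descend x k k′ ∷ ks) } }
      where
      vanish : ∀ a b → a * b + - b * a ≡ 0ℤ
      vanish = solve-∀

      descend : ∀ x → dot x c ≡ 0ℤ → dot x (combine (c n) g (- g n) c) ≡ 0ℤ → dot x g ≡ 0ℤ
      descend x k k′ = *-cancel-0 cn≢0 (begin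
        c n * dot x g                       ≡⟨ pad (c n * dot x g) (- g n) ⟩
        c n * dot x g + - g n * 0ℤ          ≡⟨ cong (λ X → c n * dot x g + - g n * X) k ⟨
        c n * dot x g + - g n * dot x c     ≡⟨ dot-combine x (c n) g (- g n) c ⟨
        dot x (combine (c n) g (- g n) c)   ≡⟨ k′ ⟩
        0ℤ ∎)
        where
        pad : ∀ X b → X ≡ X + b * 0ℤ
        pad = solve-∀

  expand-cleared : ∀ n pre {cs} → All (λ c → c n ≡ 0ℤ) cs → expand n pre cs ≡ 0ℤ
  expand-cleared n pre []                  = refl
  expand-cleared n pre {c ∷ cs} (cn≡0 ∷ z) rewrite cn≡0 | expand-cleared n (pre ++ c ∷ []) z = refl

  -- After elimination only the pivot can have a nonzero top entry. If it has none, the unit vector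
  -- of the top row kills all columns. Otherwise the determinant is `g n` times the remaining minor,
  -- and a kernel vector `y` of that minor is lifted: `y` is scaled by `g n`, so that the top
  -- coordinate that kills `g` is the integer `- dot y g`.
  singular⇒kernel : ∀ n cs → length cs ≡ n → D n cs ≡ 0ℤ →
    ∃ λ (x : Vec ℤ n) → Any (_≢ 0ℤ) x × Kills x cs
  singular⇒kernel zero    []       _   ()
  singular⇒kernel (suc n) (c ∷ cs) len Dcs≡0 with reduce n c cs
  ... | record { pivot = g ; rest = gs ; length-eq = len′ ; cleared = zeros ; singular = sing ; kernel = ker }
    with g n ≟ 0ℤ
  ... | yes gn≡0 = 1ℤ ∷ replicate n 0ℤ , here (λ ()) , ker (1ℤ ∷ replicate n 0ℤ) (killed g gn≡0 ∷ all-killed zeros)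
    where
    killed : ∀ r → r n ≡ 0ℤ → 1ℤ * r n + dot (replicate n 0ℤ) r ≡ 0ℤ
    killed r rn≡0 rewrite rn≡0 | dot-0 n r = refl

    all-killed : ∀ {rs} → All (λ r → r n ≡ 0ℤ) rs → Kills (1ℤ ∷ replicate n 0ℤ) rs
    all-killed []                 = []
    all-killed {r ∷ _} (z ∷ zs) = killed r z ∷ all-killed zs
  ... | no gn≢0 =
    let y , y≢0 , kills = singular⇒kernel n gs (trans len′ (ℕ.suc-injective len)) minor≡0
    in - dot y g ∷ map (g n *_) y
     , there (Any.map⁺ (Any.map (λ yi≢0 eq → yi≢0 (*-cancel-0 gn≢0 eq)) y≢0))
     , ker (- dot y g ∷ map (g n *_) y) (trans (cong (λ X → - dot y g * g n + X) (dot-scale (g n) y g)) (vanish (dot y g) (g n))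
                ∷ all-killed y zeros kills)
    where
    vanish : ∀ X a → - X * a + a * X ≡ 0ℤ
    vanish = solve-∀

    Dgs≡0 : g n * D n gs - expand n (g ∷ []) gs ≡ 0ℤ
    Dgs≡0 = sing [] Dcs≡0

    minor≡0 : D n gs ≡ 0ℤ
    minor≡0 = *-cancel-0 gn≢0 (trans (sym (+-identityʳ _))
      (trans (cong (λ X → g n * D n gs - X) (sym (expand-cleared n (g ∷ []) zeros))) Dgs≡0))

    all-killed : ∀ y {rs} → All (λ r → r n ≡ 0ℤ) rs → Kills y rs → Kills (- dot y g ∷ map (g n *_) y) rs
    all-killed y []       []       = []
    all-killed y {r ∷ rs} (z ∷ zs) (k ∷ ks) = killed ∷ all-killed y zs ks
      where
      killed : - dot y g * r n + dot (map (g n *_) y) r ≡ 0ℤ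
      killed rewrite z | dot-scale (g n) y r | k | *-zeroʳ (g n) | *-zeroʳ (- dot y g) = refl

  -- Agreement with the expansion that defines `det`.

  sumFin-cong : ∀ n {g h : Fin n → ℤ} → (∀ j → g j ≡ h j) → sumFin n g ≡ sumFin n h
  sumFin-cong zero    eq = refl
  sumFin-cong (suc n) eq = cong₂ _+_ (eq fzero) (sumFin-cong n (eq ∘ fsuc))

  sumFin-neg : ∀ n (g : Fin n → ℤ) → sumFin n (λ j → - g j) ≡ - sumFin n g
  sumFin-neg zero    g = refl
  sumFin-neg (suc n) g = trans (cong (λ X → - g fzero + X) (sumFin-neg n (g ∘ fsuc))) (split (g fzero) _)
    where
    split : ∀ a b → - a + - b ≡ - (a + b)
    split = solve-∀

  altSign-suc : ∀ k → altSign (suc k) ≡ - altSign k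
  altSign-suc zero          = refl
  altSign-suc (suc zero)    = refl
  altSign-suc (suc (suc k)) = altSign-suc k

  expand-tabulate : ∀ n pre m (g : Fin (suc m) → Column) → expand n pre (tabulate g) ≡
    sumFin (suc m) (λ j → altSign (toℕ j) * g j n * D n (pre ++ tabulate (g ∘ punchIn j)))
  expand-tabulate n pre zero g rewrite ++-identityʳ pre = single (g fzero n) (D n pre)
    where
    single : ∀ a X → a * X - 0ℤ ≡ 1ℤ * a * X + 0ℤ
    single = solve-∀
  expand-tabulate n pre (suc m) g = begin
    g fzero n * minor fzero - expand n (pre ++ g fzero ∷ []) (tabulate (g ∘ fsuc))
      ≡⟨ cong (λ X → g fzero n * minor fzero - X) (expand-tabulate n (pre ++ g fzero ∷ []) m (g ∘ fsuc)) ⟩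
    g fzero n * minor fzero - sumFin (suc m) term
      ≡⟨ cong (λ X → g fzero n * minor fzero + X) (sumFin-neg (suc m) term) ⟨
    g fzero n * minor fzero + sumFin (suc m) (λ j → - term j)
      ≡⟨ cong₂ _+_ (unit (g fzero n) (minor fzero)) (sumFin-cong (suc m) flip) ⟩
    sumFin (suc (suc m)) (λ j → altSign (toℕ j) * g j n * minor j) ∎
    where
    minor : Fin (suc (suc m)) → ℤ
    minor j = D n (pre ++ tabulate (g ∘ punchIn j))

    term : Fin (suc m) → ℤ
    term j = altSign (toℕ j) * g (fsuc j) n * D n ((pre ++ g fzero ∷ []) ++ tabulate (g ∘ fsuc ∘ punchIn j))

    unit : ∀ a X → a * X ≡ 1ℤ * a * X
    unit = solve-∀

    signs : ∀ s a X → - (s * a * X) ≡ - s * a * X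
    signs = solve-∀

    flip : ∀ j → - term j ≡ altSign (suc (toℕ j)) * g (fsuc j) n * minor (fsuc j)
    flip j rewrite ++-assoc pre (g fzero ∷ []) (tabulate (g ∘ fsuc ∘ punchIn j)) | altSign-suc (toℕ j) =
      signs (altSign (toℕ j)) (g (fsuc j) n) (minor (fsuc j))

  det≡D : ∀ n {A : Fin n → Fin n → ℤ} (g : Fin n → Column) →
    (∀ r c → A r c ≡ g c (n ℕ.∸ suc (toℕ r))) → det n A ≡ D n (tabulate g)
  det≡D zero    g eq = refl
  det≡D (suc n) g eq = trans
    (sumFin-cong (suc n) (λ j → cong₂ (λ X Y → altSign (toℕ j) * X * Y) (eq fzero j)
      (det≡D n (g ∘ punchIn j) (λ r c → eq (fsuc r) (punchIn j c)))))
    (sym (expand-tabulate n [] n g))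

-- Integer polynomials: roots, degrees and pseudo-division.

module Polynomials where
  open Determinants using (*-cancel-0)
  open import Data.Nat.ListAction using (product)
  open import Data.Nat.Primality using (euclidsLemma; prime⇒nonZero)
  open import Data.Nat.Primality.Factorisation using (factorise; module PrimeFactorisation)
  open import Data.Integer using (+_; -[1+_]; 1ℤ; -1ℤ; _+_; _-_; _*_; _≟_)
  open import Data.Integer.Properties using (*-zeroʳ; *-identityˡ; +-identityˡ; +-identityʳ; *-comm; abs-*; pos-*)
  open import Data.Integer.Properties using (+-injective; i-j≡0⇒i≡j; ∣i∣≡0⇒i≡0; *-cancelˡ-≡)
  open import Data.Integer.Divisibility.Signed using (_∣_; divides; ∣ᵤ⇒∣; ∣⇒∣ᵤ; ∣m+n∣m⇒∣n; ∣m⇒∣m*n)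
  open import Data.List using (replicate)
  open ≡-Reasoning

  coeff-+ₚ : ∀ p q k → coeff (p +ₚ q) k ≡ coeff p k + coeff q k
  coeff-+ₚ []      q       k       = sym (0+ _)
    where
    0+ : ∀ a → 0ℤ + a ≡ a
    0+ = solve-∀
  coeff-+ₚ (a ∷ p) []      k       = sym (+-identityʳ _)
  coeff-+ₚ (a ∷ p) (b ∷ q) zero    = refl
  coeff-+ₚ (a ∷ p) (b ∷ q) (suc k) = coeff-+ₚ p q k

  coeff-scale : ∀ c p k → coeff (scale c p) k ≡ c * coeff p k
  coeff-scale c []      k       = sym (*-zeroʳ c)
  coeff-scale c (a ∷ p) zero    = refl
  coeff-scale c (a ∷ p) (suc k) = coeff-scale c p k

  coeff-beyond : ∀ p {k} → length p ℕ.≤ k → coeff p k ≡ 0ℤ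
  coeff-beyond []      _         = refl
  coeff-beyond (a ∷ p) (s≤s l≤k) = coeff-beyond p l≤k

  length-scale : ∀ c p → length (scale c p) ≡ length p
  length-scale c []      = refl
  length-scale c (a ∷ p) = cong suc (length-scale c p)

  eval-+ₚ : ∀ p q x → eval (p +ₚ q) x ≡ eval p x + eval q x
  eval-+ₚ []      q       x = 0+ _
    where
    0+ : ∀ a → a ≡ 0ℤ + a
    0+ = solve-∀
  eval-+ₚ (a ∷ p) []      x = sym (+-identityʳ _)
  eval-+ₚ (a ∷ p) (b ∷ q) x =
    trans (cong (λ X → a + b + x * X) (eval-+ₚ p q x)) (regroup a b x (eval p x) (eval q x))
    where
    regroup : ∀ a b x P Q → a + b + x * (P + Q) ≡ a + x * P + (b + x * Q)
    regroup = solve-∀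

  eval-scale : ∀ c p x → eval (scale c p) x ≡ c * eval p x
  eval-scale c []      x = sym (*-zeroʳ c)
  eval-scale c (a ∷ p) x =
    trans (cong (λ X → c * a + x * X) (eval-scale c p x)) (regroup c a x (eval p x))
    where
    regroup : ∀ c a x P → c * a + x * (c * P) ≡ c * (a + x * P)
    regroup = solve-∀

  eval-*ₚ : ∀ p q x → eval (p *ₚ q) x ≡ eval p x * eval q x
  eval-*ₚ []      q x = refl
  eval-*ₚ (a ∷ p) q x = begin
    eval (scale a q +ₚ (0ℤ ∷ (p *ₚ q))) x            ≡⟨ eval-+ₚ (scale a q) (0ℤ ∷ (p *ₚ q)) x ⟩
    eval (scale a q) x + (0ℤ + x * eval (p *ₚ q) x)  ≡⟨ cong₂ (λ X Y → X + (0ℤ + x * Y)) (eval-scale a q x) (eval-*ₚ p q x) ⟩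
    a * eval q x + (0ℤ + x * (eval p x * eval q x))  ≡⟨ regroup a x (eval p x) (eval q x) ⟩
    (a + x * eval p x) * eval q x ∎
    where
    regroup : ∀ a x P Q → a * Q + (0ℤ + x * (P * Q)) ≡ (a + x * P) * Q
    regroup = solve-∀

  eval-≈[] : ∀ p → p ≈ₚ [] → ∀ x → eval p x ≡ 0ℤ
  eval-≈[] []      p≈0 x = refl
  eval-≈[] (a ∷ p) p≈0 x rewrite p≈0 0 | eval-≈[] p (p≈0 ∘ suc) x | *-zeroʳ x = refl

  eval-cong : ∀ p q → p ≈ₚ q → ∀ x → eval p x ≡ eval q x
  eval-cong []      q       p≈q x = sym (eval-≈[] q (sym ∘ p≈q) x)
  eval-cong (a ∷ p) []      p≈q x = eval-≈[] (a ∷ p) p≈q x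
  eval-cong (a ∷ p) (b ∷ q) p≈q x = cong₂ (λ X Y → X + x * Y) (p≈q 0) (eval-cong p q (p≈q ∘ suc) x)

  data HasDegree : Poly → ℕ → Set where
    constant : ∀ {a} → a ≢ 0ℤ → HasDegree (a ∷ []) 0
    _∷_      : ∀ a {p n} → HasDegree p n → HasDegree (a ∷ p) (suc n)

  hasDegree : ∀ p n → length p ≡ suc n → coeff p n ≢ 0ℤ → HasDegree p n
  hasDegree (a ∷ [])    zero    _   a≢0 = constant a≢0
  hasDegree (a ∷ b ∷ p) (suc n) len l≢0 = a ∷ hasDegree (b ∷ p) n (ℕ.suc-injective len) l≢0

  degree-length : ∀ {p n} → HasDegree p n → length p ≡ suc n
  degree-length (constant _) = refl
  degree-length (_ ∷ h)      = cong suc (degree-length h)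

  leading≢0 : ∀ {p n} → HasDegree p n → coeff p n ≢ 0ℤ
  leading≢0 (constant a≢0) = a≢0
  leading≢0 (_ ∷ h)        = leading≢0 h

  unscale-degree : ∀ c p {n} → HasDegree (scale c p) n → HasDegree p n
  unscale-degree c (a ∷ [])    (constant ca≢0) = constant (λ { refl → ca≢0 (*-zeroʳ c) })
  unscale-degree c (a ∷ b ∷ p) (_ ∷ h)         = a ∷ unscale-degree c (b ∷ p) h

  trim : ∀ p → p ≈ₚ [] ⊎ ∃₂ λ q n → HasDegree q n × n ℕ.< length p × p ≈ₚ q
  trim [] = inj₁ (λ _ → refl)
  trim (a ∷ p) with trim p
  ... | inj₂ (q , n , h , n<l , p≈q) = inj₂ (a ∷ q , suc n , a ∷ h , s≤s n<l , λ { zero → refl ; (suc k) → p≈q k })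
  ... | inj₁ p≈0 with a ≟ 0ℤ
  ...   | yes refl = inj₁ (λ { zero → refl ; (suc k) → p≈0 k })
  ...   | no a≢0   = inj₂ (a ∷ [] , 0 , constant a≢0 , s≤s z≤n , λ { zero → refl ; (suc k) → p≈0 k })

  -- Synthetic division: the coefficients of the quotient are the values at `r` of the successive
  -- tails of `p`, and the leading coefficient is inherited from `p`.
  divide-linear : ∀ r {p n} → HasDegree p (suc n) →
    ∃ λ q → HasDegree q n × ∀ x → eval p x ≡ eval p r + (x - r) * eval q x
  divide-linear r {a ∷ b ∷ []} (_ ∷ constant b≢0) = b ∷ [] , constant b≢0 , λ x → linear a b r x
    where
    linear : ∀ a b r x → a + x * (b + x * 0ℤ) ≡ a + r * (b + r * 0ℤ) + (x - r) * (b + x * 0ℤ)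
    linear = solve-∀
  divide-linear r {a ∷ p} (_ ∷ h@(_ ∷ _)) =
    let q , hq , eq = divide-linear r h
    in eval p r ∷ q , eval p r ∷ hq , λ x →
      trans (cong (λ X → a + x * X) (eq x)) (regroup a r x (eval p r) (eval q x))
    where
    regroup : ∀ a r x P Q → a + x * (P + (x - r) * Q) ≡ a + r * P + (x - r) * (P + x * Q)
    regroup = solve-∀

  deflate : ∀ {p n} x → HasDegree p n → eval p x ≡ 0ℤ →
    ∃₂ λ q m → n ≡ suc m × HasDegree q m × (∀ {y} → x ≢ y → eval p y ≡ 0ℤ → eval q y ≡ 0ℤ)
  deflate x (constant {a} a≢0) px≡0 = contradiction (trans (unit a x) px≡0) a≢0
    where
    unit : ∀ a x → a ≡ a + x * 0ℤ
    unit = solve-∀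
  deflate x h@(_ ∷ _) px≡0 =
    let q , hq , eq = divide-linear x h
    in q , _ , refl , hq , λ {y} x≢y py≡0 →
      *-cancel-0 (λ y-x≡0 → x≢y (sym (i-j≡0⇒i≡j y x y-x≡0)))
        (trans (trans (sym (0+ _)) (cong (λ X → X + (y - x) * eval q y) (sym px≡0))) (trans (sym (eq y)) py≡0))
    where
    0+ : ∀ a → 0ℤ + a ≡ a
    0+ = solve-∀

  -- Two polynomials are treated at once so that f − c and f + c can share the induction.
  roots-bounded : ∀ {p q m n} xs → HasDegree p m → HasDegree q n → Unique xs → m ℕ.+ n ℕ.< length xs →
    ¬ All (λ x → eval p x ≡ 0ℤ ⊎ eval q x ≡ 0ℤ) xs
  roots-bounded {m = m} {n} (x ∷ xs) hp hq (x∉xs ∷ unique) m+n<l (inj₁ px≡0 ∷ roots)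
    with _ , m′ , refl , hp′ , root ← deflate x hp px≡0 =
    roots-bounded xs hp′ hq unique (ℕ.s≤s⁻¹ m+n<l)
      (All.zipWith (λ { (x≢y , inj₁ r) → inj₁ (root x≢y r) ; (_ , inj₂ r) → inj₂ r }) (x∉xs , roots))
  roots-bounded {m = m} {n} (x ∷ xs) hp hq (x∉xs ∷ unique) m+n<l (inj₂ qx≡0 ∷ roots)
    with _ , n′ , refl , hq′ , root ← deflate x hq qx≡0 =
    roots-bounded xs hp hq′ unique (ℕ.s≤s⁻¹ (subst (ℕ._< suc (length xs)) (ℕ.+-suc m n′) m+n<l))
      (All.zipWith (λ { (_ , inj₁ r) → inj₁ r ; (x≢y , inj₂ r) → inj₂ (root x≢y r) }) (x∉xs , roots))

  eval≡0⇒≈[] : ∀ p → (∀ x → eval p x ≡ 0ℤ) → p ≈ₚ []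
  eval≡0⇒≈[] p p≡0 with trim p
  ... | inj₁ p≈0 = p≈0
  ... | inj₂ (q , n , hq , _ , p≈q) = contradiction
    (All.universal (λ x → inj₁ (trans (sym (eval-cong p q p≈q x)) (p≡0 x))) points)
    -- The second polynomial is the rootless constant 1, so the joint bound becomes the usual one
    -- for `q`: at most `n` roots.
    (roots-bounded points hq (constant {1ℤ} (λ ()))
      (applyUpTo⁺₁ +_ (suc n) (λ i<j _ eq → ℕ.<⇒≢ i<j (+-injective eq)))
      (s≤s (ℕ.≤-reflexive (trans (ℕ.+-identityʳ n) (sym (length-applyUpTo (+_ ∘ suc) n))))))
    where
    points : List ℤ
    points = applyUpTo +_ (suc n)

  -- This allows polynomial identities to be proved pointwise, as integer identities for the ring
  -- solver, and then read off coefficientwise.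
  eval-injective : ∀ p q → (∀ x → eval p x ≡ eval q x) → p ≈ₚ q
  eval-injective p q eq k = i-j≡0⇒i≡j _ _ (begin
    coeff p k - coeff q k              ≡⟨ negate (coeff p k) (coeff q k) ⟩
    coeff p k + -1ℤ * coeff q k        ≡⟨ cong (λ X → coeff p k + X) (coeff-scale -1ℤ q k) ⟨
    coeff p k + coeff (scale -1ℤ q) k  ≡⟨ coeff-+ₚ p (scale -1ℤ q) k ⟨
    coeff (p +ₚ scale -1ℤ q) k         ≡⟨ eval≡0⇒≈[] (p +ₚ scale -1ℤ q) difference k ⟩
    0ℤ ∎)
    where
    negate : ∀ a b → a - b ≡ a + -1ℤ * b
    negate = solve-∀

    vanish : ∀ a → a + -1ℤ * a ≡ 0ℤ
    vanish = solve-∀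

    difference : ∀ x → eval (p +ₚ scale -1ℤ q) x ≡ 0ℤ
    difference x = begin
      eval (p +ₚ scale -1ℤ q) x            ≡⟨ eval-+ₚ p (scale -1ℤ q) x ⟩
      eval p x + eval (scale -1ℤ q) x      ≡⟨ cong₂ _+_ (eq x) (eval-scale -1ℤ q x) ⟩
      eval q x + -1ℤ * eval q x            ≡⟨ vanish (eval q x) ⟩
      0ℤ ∎

  *ₚ-leading≢0 : ∀ {g f m n} → HasDegree g m → HasDegree f n → coeff (g *ₚ f) (m ℕ.+ n) ≢ 0ℤ
  *ₚ-leading≢0 {f = f} {n = n} (constant {a} a≢0) hf eq = leading≢0 hf (*-cancel-0 a≢0 (begin
    a * coeff f n                              ≡⟨ coeff-scale a f n ⟨
    coeff (scale a f) n                        ≡⟨ +-identityʳ _ ⟨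
    coeff (scale a f) n + 0ℤ                   ≡⟨ cong (λ X → coeff (scale a f) n + X) (coeff-0 n) ⟨
    coeff (scale a f) n + coeff (0ℤ ∷ []) n    ≡⟨ coeff-+ₚ (scale a f) (0ℤ ∷ []) n ⟨
    coeff ((a ∷ []) *ₚ f) n                    ≡⟨ eq ⟩
    0ℤ ∎))
    where
    coeff-0 : ∀ k → coeff (0ℤ ∷ []) k ≡ 0ℤ
    coeff-0 zero    = refl
    coeff-0 (suc k) = refl
  *ₚ-leading≢0 {a ∷ g} {f} {suc m} {n} (_ ∷ hg) hf eq = *ₚ-leading≢0 hg hf (begin
    coeff (g *ₚ f) (m ℕ.+ n)
      ≡⟨ 0+ a _ ⟨
    a * 0ℤ + coeff (g *ₚ f) (m ℕ.+ n)
      ≡⟨ cong (λ X → a * X + coeff (g *ₚ f) (m ℕ.+ n)) (coeff-beyond f (ℕ.≤-trans (ℕ.≤-reflexive (degree-length hf)) (s≤s (ℕ.m≤n+m n m)))) ⟨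
    a * coeff f (suc m ℕ.+ n) + coeff (g *ₚ f) (m ℕ.+ n)
      ≡⟨ cong (λ X → X + coeff (g *ₚ f) (m ℕ.+ n)) (coeff-scale a f (suc m ℕ.+ n)) ⟨
    coeff (scale a f) (suc m ℕ.+ n) + coeff (0ℤ ∷ (g *ₚ f)) (suc m ℕ.+ n)
      ≡⟨ coeff-+ₚ (scale a f) (0ℤ ∷ (g *ₚ f)) (suc m ℕ.+ n) ⟨
    coeff ((a ∷ g) *ₚ f) (suc m ℕ.+ n)
      ≡⟨ eq ⟩
    0ℤ ∎)
    where
    0+ : ∀ a b → a * 0ℤ + b ≡ b
    0+ = solve-∀

  -- If `g` had a degree `m`, the product would have a nonzero coefficient at `m + d`, beyond the
  -- end of `s`.
  short-multiple : ∀ {f d} s g → HasDegree f d → length s ℕ.≤ d →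
    (∀ x → eval s x ≡ eval g x * eval f x) → g ≈ₚ []
  short-multiple {f} {d} s g hf l≤d eq with trim g
  ... | inj₁ g≈0 = g≈0
  ... | inj₂ (h , m , hh , _ , g≈h) = contradiction
    (trans (sym (s≈hf (m ℕ.+ d))) (coeff-beyond s (ℕ.≤-trans l≤d (ℕ.m≤n+m d m))))
    (*ₚ-leading≢0 hh hf)
    where
    s≈hf : s ≈ₚ (h *ₚ f)
    s≈hf = eval-injective s (h *ₚ f) (λ x → begin
      eval s x            ≡⟨ eq x ⟩
      eval g x * eval f x ≡⟨ cong (λ X → X * eval f x) (eval-cong g h g≈h x) ⟩
      eval h x * eval f x ≡⟨ eval-*ₚ h f x ⟨
      eval (h *ₚ f) x ∎)

  -- The lists have equal length, so the recursion meets both leading coefficients at once: `b` is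
  -- that of `v` and `t` the last entry of `s`. The remainder is `b s - t v`, whose top entry
  -- cancels.
  cancel-leading : ∀ {v e} s → HasDegree v e → length s ≡ suc e →
    ∃₂ λ b t → ∃ λ r → b ≢ 0ℤ × length r ≡ e × ∀ x → b * eval s x ≡ t * eval v x + eval r x
  cancel-leading (a ∷ []) (constant {b} b≢0) _ = b , a , [] , b≢0 , refl , λ x → exchange a b x
    where
    exchange : ∀ a b x → b * (a + x * 0ℤ) ≡ a * (b + x * 0ℤ) + 0ℤ
    exchange = solve-∀
  cancel-leading (a ∷ s) (_∷_ a′ {v} h) len =
    let b , t , r , b≢0 , len-r , eq = cancel-leading s h (ℕ.suc-injective len)
    in b , t , b * a - t * a′ ∷ r , b≢0 , cong suc len-r , λ x → begin
      b * (a + x * eval s x)                         ≡⟨ expose a b x (eval s x) ⟩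
      b * a + x * (b * eval s x)                     ≡⟨ cong (λ X → b * a + x * X) (eq x) ⟩
      b * a + x * (t * eval v x + eval r x)          ≡⟨ regroup a a′ b t x (eval v x) (eval r x) ⟩
      t * (a′ + x * eval v x) + (b * a - t * a′ + x * eval r x) ∎
    where
    expose : ∀ a b x S → b * (a + x * S) ≡ b * a + x * (b * S)
    expose = solve-∀

    regroup : ∀ a a′ b t x V R → b * a + x * (t * V + R) ≡ t * (a′ + x * V) + (b * a - t * a′ + x * R)
    regroup = solve-∀

  -- Division with remainder over ℚ, the denominators being collected in `c`. Given the division of
  -- `p`, the polynomial `c a + X r` has just one entry too many, so a single cancellation restores
  -- the length. Remainders are padded with zeros to length exactly `e`, as that cancellation
  -- requires.
  pseudo-divide : ∀ {v e} → HasDegree v e → ∀ p →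
    ∃₂ λ c q → ∃ λ r → c ≢ 0ℤ × length r ≡ e × ∀ x → c * eval p x ≡ eval q x * eval v x + eval r x
  pseudo-divide {v} {e} h [] =
    1ℤ , [] , replicate e 0ℤ , (λ ()) , length-replicate e , λ x →
      trans (sym (eval-≈[] (replicate e 0ℤ) (zeros e) x)) (sym (+-identityˡ (eval (replicate e 0ℤ) x)))
    where
    zeros : ∀ e → replicate e 0ℤ ≈ₚ []
    zeros zero    k       = refl
    zeros (suc e) zero    = refl
    zeros (suc e) (suc k) = zeros e k
  pseudo-divide {v} h (a ∷ p) =
    let c , q , r  , c≢0 , len , eq = pseudo-divide h p
        b , t , r′ , b≢0 , len′ , eq′ = cancel-leading (c * a ∷ r) h (cong suc len)
    in b * c , t ∷ scale b q , r′ , (λ bc≡0 → c≢0 (*-cancel-0 b≢0 bc≡0)) , len′ , λ x → begin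
      b * c * (a + x * eval p x)
        ≡⟨ expose a b c x (eval p x) ⟩
      b * (c * a) + x * b * (c * eval p x)
        ≡⟨ cong (λ X → b * (c * a) + x * b * X) (eq x) ⟩
      b * (c * a) + x * b * (eval q x * eval v x + eval r x)
        ≡⟨ split a b c x (eval q x) (eval v x) (eval r x) ⟩
      b * (c * a + x * eval r x) + x * b * eval q x * eval v x
        ≡⟨ cong (λ X → X + x * b * eval q x * eval v x) (eq′ x) ⟩
      t * eval v x + eval r′ x + x * b * eval q x * eval v x
        ≡⟨ collect b t x (eval q x) (eval v x) (eval r′ x) ⟩
      (t + x * (b * eval q x)) * eval v x + eval r′ x
        ≡⟨ cong (λ X → (t + x * X) * eval v x + eval r′ x) (eval-scale b q x) ⟨
      (t + x * eval (scale b q) x) * eval v x + eval r′ x ∎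
    where
    expose : ∀ a b c x P → b * c * (a + x * P) ≡ b * (c * a) + x * b * (c * P)
    expose = solve-∀

    split : ∀ a b c x Q V R → b * (c * a) + x * b * (Q * V + R) ≡ b * (c * a + x * R) + x * b * Q * V
    split = solve-∀

    collect : ∀ b t x Q V R → t * V + R + x * b * Q * V ≡ (t + x * (b * Q)) * V + R
    collect = solve-∀

  -- Gauss's lemma and the consequences of irreducibility.

  infix 4 _∣ₚ_

  _∣ₚ_ : ℕ → Poly → Set
  p ∣ₚ u = ∀ k → + p ∣ coeff u k

  ∣ₚ⇒scale : ∀ {p} u → p ∣ₚ u → ∃ λ u′ → u ≡ scale (+ p) u′
  ∣ₚ⇒scale []      p∣u = [] , refl
  ∣ₚ⇒scale {p} (a ∷ u) p∣u with p∣u 0 | ∣ₚ⇒scale u (p∣u ∘ suc)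
  ... | divides a′ a≡ | u′ , u≡ = a′ ∷ u′ , cong₂ _∷_ (trans a≡ (*-comm a′ (+ p))) u≡

  *ₚ-∷ : ∀ u b v → (u *ₚ (b ∷ v)) ≈ₚ (scale b u +ₚ (0ℤ ∷ (u *ₚ v)))
  *ₚ-∷ u b v = eval-injective (u *ₚ (b ∷ v)) (scale b u +ₚ (0ℤ ∷ (u *ₚ v))) (λ x → begin
    eval (u *ₚ (b ∷ v)) x                             ≡⟨ eval-*ₚ u (b ∷ v) x ⟩
    eval u x * (b + x * eval v x)                     ≡⟨ regroup b x (eval u x) (eval v x) ⟩
    b * eval u x + (0ℤ + x * (eval u x * eval v x))   ≡⟨ cong₂ (λ X Y → X + (0ℤ + x * Y)) (eval-scale b u x) (eval-*ₚ u v x) ⟨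
    eval (scale b u) x + (0ℤ + x * eval (u *ₚ v) x)   ≡⟨ eval-+ₚ (scale b u) (0ℤ ∷ (u *ₚ v)) x ⟨
    eval (scale b u +ₚ (0ℤ ∷ (u *ₚ v))) x ∎)
    where
    regroup : ∀ b x U V → U * (b + x * V) ≡ b * U + (0ℤ + x * (U * V))
    regroup = solve-∀

  euclidℤ : ∀ {p} → Prime p → ∀ a b → + p ∣ a * b → (+ p ∣ a) ⊎ (+ p ∣ b)
  euclidℤ {p} pr a b p∣ab with euclidsLemma ∣ a ∣ ∣ b ∣ pr (subst (p ℕ.∣_) (abs-* a b) (∣⇒∣ᵤ p∣ab))
  ... | inj₁ p∣a = inj₁ (∣ᵤ⇒∣ p∣a)
  ... | inj₂ p∣b = inj₂ (∣ᵤ⇒∣ p∣b)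

  -- The product of the constant terms is divisible by `p`, hence one of them is. Dropping that term
  -- subtracts a multiple of `p` and leaves a product with one shorter factor, so the argument
  -- repeats.
  gauss : ∀ {p} → Prime p → ∀ u v → p ∣ₚ (u *ₚ v) → p ∣ₚ u ⊎ p ∣ₚ v
  gauss pr []      v       _   = inj₁ (λ _ → divides 0ℤ refl)
  gauss pr (a ∷ u) []      _   = inj₂ (λ _ → divides 0ℤ refl)
  gauss {p} pr (a ∷ u) (b ∷ v) p∣uv =
    [ (λ p∣a → Sum.map₁ (λ p∣u → λ { zero → p∣a ; (suc k) → p∣u k })
        (gauss pr u (b ∷ v) (λ k → ∣m+n∣m⇒∣n
          (subst (+ p ∣_) (coeff-+ₚ (scale a v) (u *ₚ (b ∷ v)) k) (p∣uv (suc k)))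
          (subst (+ p ∣_) (sym (coeff-scale a v k)) (∣m⇒∣m*n (coeff v k) p∣a)))))
    , (λ p∣b → Sum.map₂ (λ p∣v → λ { zero → p∣b ; (suc k) → p∣v k })
        (gauss pr (a ∷ u) v (λ k → ∣m+n∣m⇒∣n
          (subst (+ p ∣_) (tail-coeff k) (p∣uv (suc k))) (∣m⇒∣m*n (coeff u k) p∣b))))
    ]′ (euclidℤ pr a b (subst (+ p ∣_) (+-identityʳ (a * b)) (p∣uv 0)))
    where
    regroup : ∀ A B C → A + (B + C) ≡ B + (A + C)
    regroup = solve-∀

    tail-coeff : ∀ k → coeff (scale a v +ₚ (u *ₚ (b ∷ v))) k ≡ b * coeff u k + coeff ((a ∷ u) *ₚ v) k
    tail-coeff k = begin
      coeff (scale a v +ₚ (u *ₚ (b ∷ v))) k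
        ≡⟨ coeff-+ₚ (scale a v) (u *ₚ (b ∷ v)) k ⟩
      coeff (scale a v) k + coeff (u *ₚ (b ∷ v)) k
        ≡⟨ cong (λ X → coeff (scale a v) k + X) (trans (*ₚ-∷ u b v k) (coeff-+ₚ (scale b u) (0ℤ ∷ (u *ₚ v)) k)) ⟩
      coeff (scale a v) k + (coeff (scale b u) k + coeff (0ℤ ∷ (u *ₚ v)) k)
        ≡⟨ regroup (coeff (scale a v) k) (coeff (scale b u) k) _ ⟩
      coeff (scale b u) k + (coeff (scale a v) k + coeff (0ℤ ∷ (u *ₚ v)) k)
        ≡⟨ cong₂ _+_ (coeff-scale b u k) (sym (coeff-+ₚ (scale a v) (0ℤ ∷ (u *ₚ v)) k)) ⟩
      b * coeff u k + coeff ((a ∷ u) *ₚ v) k ∎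

  sign-split : ∀ c → ∃ λ s → s * s ≡ 1ℤ × c ≡ s * + ∣ c ∣
  sign-split (+ n)    = 1ℤ , refl , sym (*-identityˡ (+ n))
  sign-split -[1+ n ] = -1ℤ , refl , cong -[1+_] (sym (ℕ.+-identityʳ n))

  -- Each prime of the constant divides all coefficients of `q` or all of `v`, by Gauss's lemma, and
  -- is divided out there; the degree of `v` never changes. The sign `s` is its own inverse and is
  -- finally moved into `q`.
  clear-primes : ∀ f {e} s → s * s ≡ 1ℤ → ∀ ps → All Prime ps → ∀ q v → HasDegree v e →
    (∀ x → s * + product ps * eval f x ≡ eval q x * eval v x) →
    ∃₂ λ q′ v′ → HasDegree v′ e × ∀ x → eval f x ≡ eval q′ x * eval v′ x
  clear-primes f s s²≡1 [] [] q v hv eq = scale s q , v , hv , λ x → begin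
    eval f x                        ≡⟨ *-identityˡ _ ⟨
    1ℤ * eval f x                   ≡⟨ cong (λ X → X * eval f x) s²≡1 ⟨
    s * s * eval f x                ≡⟨ regroup s (eval f x) ⟩
    s * (s * 1ℤ * eval f x)         ≡⟨ cong (s *_) (eq x) ⟩
    s * (eval q x * eval v x)       ≡⟨ assoc s (eval q x) (eval v x) ⟩
    s * eval q x * eval v x         ≡⟨ cong (λ X → X * eval v x) (eval-scale s q x) ⟨
    eval (scale s q) x * eval v x ∎
    where
    regroup : ∀ s F → s * s * F ≡ s * (s * 1ℤ * F)
    regroup = solve-∀

    assoc : ∀ s Q V → s * (Q * V) ≡ s * Q * V
    assoc = solve-∀
  clear-primes f {e} s s²≡1 (p ∷ ps) (pr ∷ primes) q v hv eq = split (gauss pr q v p∣qv)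
    where
    c : ℤ
    c = s * + product ps

    regroup : ∀ s P N F → s * (P * N) * F ≡ P * (s * N * F)
    regroup = solve-∀

    assocˡ : ∀ P Q V → P * Q * V ≡ P * (Q * V)
    assocˡ = solve-∀

    assocʳ : ∀ P Q V → Q * (P * V) ≡ P * (Q * V)
    assocʳ = solve-∀

    eq′ : ∀ x → + p * (c * eval f x) ≡ eval q x * eval v x
    eq′ x = begin
      + p * (c * eval f x)                       ≡⟨ regroup s (+ p) (+ product ps) (eval f x) ⟨
      s * (+ p * + product ps) * eval f x        ≡⟨ cong (λ X → s * X * eval f x) (pos-* p (product ps)) ⟨
      s * + (p ℕ.* product ps) * eval f x        ≡⟨ eq x ⟩
      eval q x * eval v x ∎

    scaled : scale (+ p) (scale c f) ≈ₚ (q *ₚ v)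
    scaled = eval-injective (scale (+ p) (scale c f)) (q *ₚ v) (λ x → begin
      eval (scale (+ p) (scale c f)) x  ≡⟨ eval-scale (+ p) (scale c f) x ⟩
      + p * eval (scale c f) x          ≡⟨ cong (+ p *_) (eval-scale c f x) ⟩
      + p * (c * eval f x)              ≡⟨ eq′ x ⟩
      eval q x * eval v x               ≡⟨ eval-*ₚ q v x ⟨
      eval (q *ₚ v) x ∎)

    p∣qv : p ∣ₚ (q *ₚ v)
    p∣qv k = divides (coeff (scale c f) k)
      (trans (sym (scaled k)) (trans (coeff-scale (+ p) (scale c f) k) (*-comm (+ p) _)))

    cancel-p : ∀ {a b} → + p * a ≡ + p * b → a ≡ b
    cancel-p {a} {b} = *-cancelˡ-≡ (+ p) a b {{prime⇒nonZero pr}}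

    split : p ∣ₚ q ⊎ p ∣ₚ v → ∃₂ λ q′ v′ → HasDegree v′ e × ∀ x → eval f x ≡ eval q′ x * eval v′ x
    split (inj₁ p∣q) with q′ , refl ← ∣ₚ⇒scale q p∣q =
      clear-primes f s s²≡1 ps primes q′ v hv (λ x → cancel-p (begin
        + p * (c * eval f x)                ≡⟨ eq′ x ⟩
        eval (scale (+ p) q′) x * eval v x  ≡⟨ cong (λ X → X * eval v x) (eval-scale (+ p) q′ x) ⟩
        + p * eval q′ x * eval v x          ≡⟨ assocˡ (+ p) (eval q′ x) (eval v x) ⟩
        + p * (eval q′ x * eval v x) ∎))
    split (inj₂ p∣v) with v′ , refl ← ∣ₚ⇒scale v p∣v =
      clear-primes f s s²≡1 ps primes q v′ (unscale-degree (+ p) v′ hv) (λ x → cancel-p (begin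
        + p * (c * eval f x)                ≡⟨ eq′ x ⟩
        eval q x * eval (scale (+ p) v′) x  ≡⟨ cong (eval q x *_) (eval-scale (+ p) v′ x) ⟩
        eval q x * (+ p * eval v′ x)        ≡⟨ assocʳ (+ p) (eval q x) (eval v′ x) ⟩
        + p * (eval q x * eval v′ x) ∎))

  clear-denominator : ∀ f {e c} q v → c ≢ 0ℤ → HasDegree v e →
    (∀ x → c * eval f x ≡ eval q x * eval v x) →
    ∃₂ λ q′ v′ → HasDegree v′ e × ∀ x → eval f x ≡ eval q′ x * eval v′ x
  clear-denominator f {c = c} q v c≢0 hv eq =
    let s , s²≡1 , c≡ = sign-split c
    in clear-primes f s s²≡1 factors factorsPrime q v hv (λ x →
      trans (cong (λ n → s * + n * eval f x) (sym isFactorisation)) (trans (cong (λ X → X * eval f x) (sym c≡)) (eq x)))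
    where open PrimeFactorisation (factorise ∣ c ∣ {{ℕ.≢-nonZero (c≢0 ∘ ∣i∣≡0⇒i≡0)}})

  unit-constant : ∀ u → IsUnit u → ∃ λ ε → u ≈ₚ (ε ∷ [])
  unit-constant u (inj₁ u≈1)  = 1ℤ , u≈1
  unit-constant u (inj₂ u≈-1) = -1ℤ , u≈-1

  -- After clearing `c`, irreducibility makes one factor a unit, hence a constant. It cannot be
  -- `v′`, of positive degree, nor `q′`, since `f` would then have degree below `d`.
  no-proper-factor : ∀ {f v d e c} q → Irreducible f → HasDegree f d → HasDegree v (suc e) → suc e ℕ.< d →
    c ≢ 0ℤ → ¬ (∀ x → c * eval f x ≡ eval q x * eval v x)
  no-proper-factor {f} {v} {d} {e} q (_ , _ , irr) hf hv e<d c≢0 eq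
    with q′ , v′ , hv′ , f≡q′v′ ← clear-denominator f q v c≢0 hv eq
    with irr q′ v′ (eval-injective f (q′ *ₚ v′) (λ x → trans (f≡q′v′ x) (sym (eval-*ₚ q′ v′ x))))
  ... | inj₂ unit with _ , v′≈ε ← unit-constant v′ unit = leading≢0 hv′ (v′≈ε (suc e))
  ... | inj₁ unit with ε , q′≈ε ← unit-constant q′ unit = leading≢0 hf (begin
    coeff f d            ≡⟨ f≈εv′ d ⟩
    coeff (scale ε v′) d ≡⟨ coeff-scale ε v′ d ⟩
    ε * coeff v′ d       ≡⟨ cong (ε *_) (coeff-beyond v′ (ℕ.≤-trans (ℕ.≤-reflexive (degree-length hv′)) e<d)) ⟩
    ε * 0ℤ               ≡⟨ *-zeroʳ ε ⟩
    0ℤ ∎)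
    where
    drop-0 : ∀ ε x V → (ε + x * 0ℤ) * V ≡ ε * V
    drop-0 = solve-∀

    f≈εv′ : f ≈ₚ scale ε v′
    f≈εv′ = eval-injective f (scale ε v′) (λ x → begin
      eval f x                        ≡⟨ f≡q′v′ x ⟩
      eval q′ x * eval v′ x           ≡⟨ cong (λ X → X * eval v′ x) (eval-cong q′ (ε ∷ []) q′≈ε x) ⟩
      (ε + x * 0ℤ) * eval v′ x        ≡⟨ drop-0 ε x (eval v′ x) ⟩
      ε * eval v′ x                   ≡⟨ eval-scale ε v′ x ⟨
      eval (scale ε v′) x ∎)

  -- Euclidean descent: the remainder of f by v satisfies the same relation as v, with smaller degree,
  -- until either it vanishes and v is a factor of f over ℚ, or v is a constant and f divides w.
  irreducible∤product : ∀ {f d} w → Irreducible f → HasDegree f d → length w ℕ.≤ d → ¬ (w ≈ₚ []) →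
    ∀ n {v e} g → HasDegree v e → e ℕ.< n → e ℕ.< d → ¬ (∀ x → eval v x * eval w x ≡ eval g x * eval f x)
  irreducible∤product {f} {d} w irr hf w≤d w≉0 (suc n) {v} {e} g hv e<n e<d eq
    with c , q , r , c≢0 , len , division ← pseudo-divide hv f | trim r
  ... | inj₂ (r′ , e′ , hr′ , e′<l , r≈r′) =
    -- From `r = c f - q v` and `v w = g f` follows `r w = (c w - q g) f`, which gives the new
    -- cofactor.
    irreducible∤product w irr hf w≤d w≉0 n (scale c w +ₚ scale -1ℤ (q *ₚ g)) hr′
      (ℕ.<-≤-trans e′<e (ℕ.s≤s⁻¹ e<n)) (ℕ.<-trans e′<e e<d) (λ x → begin
        eval r′ x * eval w x
          ≡⟨ cong (λ X → X * eval w x) (eval-cong r r′ r≈r′ x) ⟨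
        eval r x * eval w x
          ≡⟨ expose (eval q x) (eval v x) (eval r x) (eval w x) ⟩
        (eval q x * eval v x + eval r x) * eval w x - eval q x * (eval v x * eval w x)
          ≡⟨ cong₂ (λ X Y → X * eval w x - eval q x * Y) (sym (division x)) (eq x) ⟩
        c * eval f x * eval w x - eval q x * (eval g x * eval f x)
          ≡⟨ collect c (eval f x) (eval w x) (eval q x) (eval g x) ⟩
        (c * eval w x + -1ℤ * (eval q x * eval g x)) * eval f x
          ≡⟨ cong (λ X → X * eval f x) (eval-cofactor x) ⟨
        eval (scale c w +ₚ scale -1ℤ (q *ₚ g)) x * eval f x ∎)
    where
    e′<e : e′ ℕ.< e
    e′<e = subst (e′ ℕ.<_) len e′<l

    expose : ∀ Q V R W → R * W ≡ (Q * V + R) * W - Q * (V * W)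
    expose = solve-∀

    collect : ∀ c F W Q G → c * F * W - Q * (G * F) ≡ (c * W + -1ℤ * (Q * G)) * F
    collect = solve-∀

    eval-cofactor : ∀ x → eval (scale c w +ₚ scale -1ℤ (q *ₚ g)) x ≡ c * eval w x + -1ℤ * (eval q x * eval g x)
    eval-cofactor x = begin
      eval (scale c w +ₚ scale -1ℤ (q *ₚ g)) x
        ≡⟨ eval-+ₚ (scale c w) (scale -1ℤ (q *ₚ g)) x ⟩
      eval (scale c w) x + eval (scale -1ℤ (q *ₚ g)) x
        ≡⟨ cong₂ _+_ (eval-scale c w x) (trans (eval-scale -1ℤ (q *ₚ g) x) (cong (-1ℤ *_) (eval-*ₚ q g x))) ⟩
      c * eval w x + -1ℤ * (eval q x * eval g x) ∎
  irreducible∤product {f} {d} w irr hf w≤d w≉0 (suc n) {v} {suc e} g hv _ e<d eq | inj₁ r≈0 =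
    no-proper-factor q irr hf hv e<d c≢0 (λ x → trans (division x)
      (trans (cong (λ X → eval q x * eval v x + X) (eval-≈[] r r≈0 x)) (+-identityʳ _)))
  irreducible∤product {f} {d} w irr hf w≤d w≉0 (suc n) {b ∷ []} {zero} g (constant b≢0) _ _ eq | inj₁ _ =
    w≉0 (eval≡0⇒≈[] w (λ x → *-cancel-0 b≢0 (begin
      b * eval w x         ≡⟨ eval-scale b w x ⟨
      eval (scale b w) x   ≡⟨ multiple x ⟩
      eval g x * eval f x  ≡⟨ cong (λ X → X * eval f x) (eval-≈[] g g≈0 x) ⟩
      0ℤ ∎)))
    where
    drop-0 : ∀ b x W → b * W ≡ (b + x * 0ℤ) * W
    drop-0 = solve-∀

    multiple : ∀ x → eval (scale b w) x ≡ eval g x * eval f x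
    multiple x = trans (eval-scale b w x) (trans (drop-0 b x (eval w x)) (eq x))

    g≈0 : g ≈ₚ []
    g≈0 = short-multiple (scale b w) g hf (subst (ℕ._≤ d) (sym (length-scale b w)) w≤d) multiple

-- Horner's rule on columns, resultants and discriminants.

module Discriminants where
  open Determinants
  open Polynomials
  open import Data.Bool using (true; false; if_then_else_)
  open import Data.Integer using (+_; -[1+_]; +[1+_]; 1ℤ; -1ℤ; _+_; _-_; _*_; _^_; NonZero)
  open import Data.Integer.Properties using (*-zeroʳ; *-identityˡ; +-identityʳ; +-identityˡ; *-comm; abs-*; i-j≡0⇒i≡j; ∣i∣≡0⇒i≡0)
  open import Data.Integer.DivMod using (_/_; _%_; a≡a%n+[a/n]*n; n%d<d)
  open import Data.Integer.Divisibility.Signed using (_∣_; divides; _∣?_; ∣n⇒∣m*n; ∣-refl)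
  open import Data.Fin.Properties using (toℕ<n)
  open import Data.List using (drop)
  open import Data.List.Relation.Unary.All.Properties using (applyUpTo⁻)
  open import Relation.Nullary.Decidable using (dec-true; dec-false)
  open ≡-Reasoning

  -- The quotient column is chosen independently of its neighbours, so divisors can be extracted
  -- from two columns in succession. It is found by deciding divisibility; the default 0 can occur
  -- only outside the `n` rows that `D n` reads.
  D-divides-column : ∀ n a w → (∀ i → i ℕ.< n → a ∣ w i) →
    ∃ λ u → ∀ xs ys → D n (xs ++ w ∷ ys) ≡ a * D n (xs ++ u ∷ ys)
  D-divides-column n a w a∣w = u , λ xs ys → D-scale n a xs ys w≡au
    where
    u : Column
    u i with a ∣? w i
    ... | yes (divides q _) = q
    ... | no _              = 0ℤ

    w≡au : ∀ i → i ℕ.< n → w i ≡ a * u i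
    w≡au i i<n with a ∣? w i
    ... | yes (divides q eq) = trans eq (*-comm q a)
    ... | no a∤wi            = contradiction (a∣w i i<n) a∤wi

  -- This is the sum of `r j * t ^ (m - 1 - j)` over `j < m`: the row `r`, read from the highest
  -- power down as in a Sylvester matrix, evaluated at `t`.
  horner : ℤ → (ℕ → ℤ) → ℕ → ℤ
  horner t r zero    = 0ℤ
  horner t r (suc m) = r m + t * horner t r m

  horner-0 : ∀ t r m → (∀ j → j ℕ.< m → r j ≡ 0ℤ) → horner t r m ≡ 0ℤ
  horner-0 t r zero    r≡0 = refl
  horner-0 t r (suc m) r≡0
    rewrite r≡0 m ℕ.≤-refl | horner-0 t r m (λ j j<m → r≡0 j (ℕ.m<n⇒m<1+n j<m)) | *-zeroʳ t = refl

  horner-cong : ∀ t {r r′} m → (∀ j → r j ≡ r′ j) → horner t r m ≡ horner t r′ m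
  horner-cong t zero    eq = refl
  horner-cong t (suc m) eq = cong₂ (λ X Y → X + t * Y) (eq m) (horner-cong t m eq)

  dot-horner : ∀ {n} t (x : Vec ℤ n) (c : ℕ → Column) m →
    dot x (λ i → horner t (λ j → c j i) m) ≡ horner t (λ j → dot x (c j)) m
  dot-horner t x c zero = dot-null x
    where
    dot-null : ∀ {n} (x : Vec ℤ n) → dot x (λ _ → 0ℤ) ≡ 0ℤ
    dot-null []       = refl
    dot-null (x ∷ xs) rewrite dot-null xs | *-zeroʳ x = refl
  dot-horner t x c (suc m) = begin
    dot x (λ i → c m i + t * horner t (λ j → c j i) m)
      ≡⟨ dot-cong x (λ i _ → cong (λ X → X + t * horner t (λ j → c j i) m) (sym (*-identityˡ (c m i)))) ⟩
    dot x (combine 1ℤ (c m) t (λ i → horner t (λ j → c j i) m))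
      ≡⟨ dot-combine x 1ℤ (c m) t (λ i → horner t (λ j → c j i) m) ⟩
    1ℤ * dot x (c m) + t * dot x (λ i → horner t (λ j → c j i) m)
      ≡⟨ cong₂ (λ X Y → X + t * Y) (*-identityˡ (dot x (c m))) (dot-horner t x c m) ⟩
    dot x (c m) + t * horner t (λ j → dot x (c j)) m ∎

  -- Adding t times the (already modified) previous column to each column in turn
  -- turns the last one into the Horner sum of all columns.
  hornerColumns : ℤ → Column → (ℕ → Column) → ℕ → List Column
  hornerColumns t u g zero    = u ∷ []
  hornerColumns t u g (suc m) = u ∷ hornerColumns t (combine 1ℤ (g 0) t u) (g ∘ suc) m

  hornerLast : ℤ → Column → (ℕ → Column) → ℕ → Column
  hornerLast t u g zero    = u
  hornerLast t u g (suc m) = hornerLast t (combine 1ℤ (g 0) t u) (g ∘ suc) m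

  hornerColumns-last : ∀ t u g m → ∃ λ init → hornerColumns t u g m ≡ init ++ hornerLast t u g m ∷ []
  hornerColumns-last t u g zero    = [] , refl
  hornerColumns-last t u g (suc m) =
    let init , eq = hornerColumns-last t (combine 1ℤ (g 0) t u) (g ∘ suc) m in u ∷ init , cong (u ∷_) eq

  hornerLast-suc : ∀ t u g m i → hornerLast t u g (suc m) i ≡ g m i + t * hornerLast t u g m i
  hornerLast-suc t u g zero    i = cong (λ X → X + t * u i) (*-identityˡ (g 0 i))
  hornerLast-suc t u g (suc m) i = hornerLast-suc t (combine 1ℤ (g 0) t u) (g ∘ suc) m i

  hornerLast≡horner : ∀ t (c : ℕ → Column) m i → hornerLast t (c 0) (c ∘ suc) m i ≡ horner t (λ j → c j i) (suc m)
  hornerLast≡horner t c zero    i = sym (trans (cong (λ X → c 0 i + X) (*-zeroʳ t)) (+-identityʳ _))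
  hornerLast≡horner t c (suc m) i =
    trans (hornerLast-suc t (c 0) (c ∘ suc) m i) (cong (λ X → c (suc m) i + t * X) (hornerLast≡horner t c m i))

  D-hornerColumns : ∀ n t pre u g m → D n (pre ++ u ∷ applyUpTo g m) ≡ D n (pre ++ hornerColumns t u g m)
  D-hornerColumns n t pre u g zero    = refl
  D-hornerColumns n t pre u g (suc m) = begin
    D n (pre ++ u ∷ g 0 ∷ applyUpTo (g ∘ suc) m)
      ≡⟨ *-identityˡ _ ⟨
    1ℤ * D n (pre ++ u ∷ g 0 ∷ applyUpTo (g ∘ suc) m)
      ≡⟨ D-combine-next n 1ℤ t u (g 0) pre (applyUpTo (g ∘ suc) m) ⟨
    D n (pre ++ u ∷ u′ ∷ applyUpTo (g ∘ suc) m)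
      ≡⟨ cong (D n) (++-assoc pre (u ∷ []) (u′ ∷ applyUpTo (g ∘ suc) m)) ⟨
    D n ((pre ++ u ∷ []) ++ u′ ∷ applyUpTo (g ∘ suc) m)
      ≡⟨ D-hornerColumns n t (pre ++ u ∷ []) u′ (g ∘ suc) m ⟩
    D n ((pre ++ u ∷ []) ++ hornerColumns t u′ (g ∘ suc) m)
      ≡⟨ cong (D n) (++-assoc pre (u ∷ []) (hornerColumns t u′ (g ∘ suc) m)) ⟩
    D n (pre ++ u ∷ hornerColumns t u′ (g ∘ suc) m) ∎
    where
    u′ : Column
    u′ = combine 1ℤ (g 0) t u

  -- The Horner operations leave the first column untouched, so `a` can still be extracted from it
  -- after the last column has become divisible by `b`. There are `suc (suc m)` columns to keep the
  -- two distinct.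
  D-divides-first-last : ∀ {a b} n t (c : ℕ → Column) m → (∀ i → i ℕ.< n → a ∣ c 0 i) →
    (∀ i → i ℕ.< n → b ∣ horner t (λ j → c j i) (suc (suc m))) →
    ∃ λ K → D n (applyUpTo c (suc (suc m))) ≡ a * (b * K)
  D-divides-first-last {a} {b} n t c m a∣first b∣last
    = let
      init , split = hornerColumns-last t (combine 1ℤ (c 1) t (c 0)) (c ∘ suc ∘ suc) m
      last = hornerLast t (c 0) (c ∘ suc) (suc m)
      u , pull = D-divides-column n a (c 0) a∣first
      w , pull′ = D-divides-column n b last
        (λ i i<n → subst (b ∣_) (sym (hornerLast≡horner t c (suc m) i)) (b∣last i i<n))
    in D n (u ∷ init ++ w ∷ []) , (begin
      D n (applyUpTo c (suc (suc m)))
        ≡⟨ D-hornerColumns n t [] (c 0) (c ∘ suc) (suc m) ⟩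
      D n (c 0 ∷ hornerColumns t (combine 1ℤ (c 1) t (c 0)) (c ∘ suc ∘ suc) m)
        ≡⟨ cong (λ cs → D n (c 0 ∷ cs)) split ⟩
      D n (c 0 ∷ init ++ last ∷ [])
        ≡⟨ pull [] (init ++ last ∷ []) ⟩
      a * D n (u ∷ init ++ last ∷ [])
        ≡⟨ cong (a *_) (pull′ (u ∷ init) []) ⟩
      a * (b * D n (u ∷ init ++ w ∷ [])) ∎)

  eval-drop : ∀ p k t → eval (drop k p) t ≡ coeff p k + t * eval (drop (suc k) p) t
  eval-drop []      zero    t = sym (trans (+-identityˡ _) (*-zeroʳ t))
  eval-drop []      (suc k) t = sym (trans (+-identityˡ _) (*-zeroʳ t))
  eval-drop (a ∷ p) zero    t = refl
  eval-drop (a ∷ p) (suc k) t = eval-drop p k t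

  drop-beyond : ∀ (p : Poly) {k} → length p ℕ.≤ k → drop k p ≡ []
  drop-beyond []      {zero}  _         = refl
  drop-beyond []      {suc k} _         = refl
  drop-beyond (a ∷ p) {suc k} (s≤s l≤k) = drop-beyond p l≤k

  module _ (deg : ℕ) (p : Poly) (shift : ℕ) where

    band-before : ∀ {j} → j ℕ.< shift → band deg p shift j ≡ 0ℤ
    band-before {j} j<s rewrite dec-false (shift ℕ.≤? j) (ℕ.<⇒≱ j<s) = refl

    band-inside : ∀ {l} → l ℕ.≤ deg → band deg p shift (shift ℕ.+ l) ≡ coeff p (deg ℕ.∸ l)
    band-inside {l} l≤d
      rewrite dec-true (shift ℕ.≤? shift ℕ.+ l) (ℕ.m≤m+n shift l) | ℕ.m+n∸m≡n shift l
            | dec-true (l ℕ.≤? deg) l≤d = refl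

    band-after : ∀ {l} → deg ℕ.< l → band deg p shift (shift ℕ.+ l) ≡ 0ℤ
    band-after {l} d<l
      rewrite dec-true (shift ℕ.≤? shift ℕ.+ l) (ℕ.m≤m+n shift l) | ℕ.m+n∸m≡n shift l
            | dec-false (l ℕ.≤? deg) (ℕ.<⇒≱ d<l) = refl

    module _ (t : ℤ) (len : length p ℕ.≤ suc deg) where

      -- Partway through the band, Horner's rule has read the coefficients from the top down to some
      -- index, and has thus evaluated a tail of `p`.
      horner-inside : ∀ l → l ℕ.≤ suc deg →
        horner t (band deg p shift) (shift ℕ.+ l) ≡ eval (drop (suc deg ℕ.∸ l) p) t
      horner-inside zero _ rewrite ℕ.+-identityʳ shift | drop-beyond p len =
        horner-0 t (band deg p shift) shift (λ _ → band-before)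
      horner-inside (suc l) (s≤s l≤d) rewrite ℕ.+-suc shift l = begin
        band deg p shift (shift ℕ.+ l) + t * horner t (band deg p shift) (shift ℕ.+ l)
          ≡⟨ cong₂ (λ X Y → X + t * Y) (band-inside l≤d) (horner-inside l (ℕ.m≤n⇒m≤1+n l≤d)) ⟩
        coeff p (deg ℕ.∸ l) + t * eval (drop (suc deg ℕ.∸ l) p) t
          ≡⟨ cong (λ k → coeff p (deg ℕ.∸ l) + t * eval (drop k p) t) (ℕ.+-∸-assoc 1 l≤d) ⟩
        coeff p (deg ℕ.∸ l) + t * eval (drop (suc (deg ℕ.∸ l)) p) t
          ≡⟨ eval-drop p (deg ℕ.∸ l) t ⟨
        eval (drop (deg ℕ.∸ l) p) t ∎

      -- The zeros before the band contribute nothing, the band yields `eval p t`, and each of the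
      -- `k` zeros after it multiplies by `t`.
      horner-band : ∀ k → horner t (band deg p shift) (shift ℕ.+ (suc deg ℕ.+ k)) ≡ t ^ k * eval p t
      horner-band zero rewrite ℕ.+-identityʳ deg = begin
        horner t (band deg p shift) (shift ℕ.+ suc deg)  ≡⟨ horner-inside (suc deg) ℕ.≤-refl ⟩
        eval (drop (deg ℕ.∸ deg) p) t                    ≡⟨ cong (λ k → eval (drop k p) t) (ℕ.n∸n≡0 deg) ⟩
        eval p t                                         ≡⟨ *-identityˡ _ ⟨
        1ℤ * eval p t ∎
      horner-band (suc k) rewrite ℕ.+-suc deg k | ℕ.+-suc shift (suc deg ℕ.+ k) = begin
        band deg p shift (shift ℕ.+ (suc deg ℕ.+ k)) + t * horner t (band deg p shift) (shift ℕ.+ (suc deg ℕ.+ k))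
          ≡⟨ cong₂ (λ X Y → X + t * Y) (band-after (s≤s (ℕ.m≤m+n deg k))) (horner-band k) ⟩
        0ℤ + t * (t ^ k * eval p t)
          ≡⟨ regroup t (t ^ k) (eval p t) ⟩
        t * t ^ k * eval p t ∎
        where
        regroup : ∀ t T P → 0ℤ + t * (T * P) ≡ t * T * P
        regroup = solve-∀

  band-first : ∀ {a} deg p shift → a ∣ coeff p deg → a ∣ band deg p shift 0
  band-first deg p zero    a∣p = a∣p
  band-first deg p (suc s) a∣p = divides 0ℤ refl

  snoc-≈[] : ∀ v a → (v ++ a ∷ []) ≈ₚ [] → v ≈ₚ [] × a ≡ 0ℤ
  snoc-≈[] []      a eq = (λ _ → refl) , eq 0
  snoc-≈[] (b ∷ v) a eq =
    let v≈0 , a≡0 = snoc-≈[] v a (eq ∘ suc) in (λ { zero → eq 0 ; (suc k) → v≈0 k }) , a≡0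

  eval-snoc : ∀ v a t → eval (v ++ a ∷ []) t ≡ eval v t + a * t ^ length v
  eval-snoc []      a t = unit a t
    where
    unit : ∀ a t → a + t * 0ℤ ≡ 0ℤ + a * 1ℤ
    unit = solve-∀
  eval-snoc (b ∷ v) a t =
    trans (cong (λ X → b + t * X) (eval-snoc v a t)) (regroup b t (eval v t) a (t ^ length v))
    where
    regroup : ∀ b t V a T → b + t * (V + a * T) ≡ b + t * V + a * (t * T)
    regroup = solve-∀

  length-snoc : ∀ (v : Poly) {a n} → length v ≡ n → length (v ++ a ∷ []) ≡ suc n
  length-snoc v {a} refl = trans (length-++ v) (ℕ.+-comm (length v) 1)

  -- A row vector applied to the rows  W, tW, …, t^(n-1)W, F, tF, …, t^(k-1)F  is a combination u F + v W.
  record Combination (k n : ℕ) (x : Vec ℤ (k ℕ.+ n)) : Set where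
    field
      u v       : Poly
      length-u  : length u ≡ k
      length-v  : length v ≡ n
      nonzero   : u ≈ₚ [] → v ≈ₚ [] → ¬ Any (_≢ 0ℤ) x
      dot≡      : ∀ t F W c → (∀ i → i ℕ.< n → c i ≡ t ^ i * W) → (∀ i → i ℕ.< k → c (i ℕ.+ n) ≡ t ^ i * F) →
                  dot x c ≡ eval u t * F + eval v t * W

  -- The head of `x` belongs to the top row, that is, to the highest power of `t`, whereas
  -- polynomials list the lowest power first. Coefficients are therefore appended at the end of `u`
  -- or `v`.
  combination : ∀ k n (x : Vec ℤ (k ℕ.+ n)) → Combination k n x
  combination zero zero [] = record
    { u = [] ; v = [] ; length-u = refl ; length-v = refl ; nonzero = λ { _ _ () } ; dot≡ = λ _ _ _ _ _ _ → refl }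
  combination zero (suc n) (x ∷ xs) = record
    { u = [] ; v = v ++ x ∷ [] ; length-u = refl ; length-v = length-snoc v length-v
    ; nonzero = λ { _ eq (here x≢0) → x≢0 (proj₂ (snoc-≈[] v x eq))
                  ; _ eq (there xs≢0) → nonzero u≈0 (proj₁ (snoc-≈[] v x eq)) xs≢0 }
    ; dot≡ = λ t F W c low high → begin
        x * c n + dot xs c
          ≡⟨ cong₂ (λ X Y → x * X + Y) (low n ℕ.≤-refl) (dot≡ t F W c (λ i i<n → low i (ℕ.m<n⇒m<1+n i<n)) (λ _ ())) ⟩
        x * (t ^ n * W) + (eval u t * F + eval v t * W)
          ≡⟨ cong₂ (λ m X → x * (t ^ m * W) + (X * F + eval v t * W)) (sym length-v) (eval-≈[] u u≈0 t) ⟩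
        x * (t ^ length v * W) + (0ℤ * F + eval v t * W)
          ≡⟨ regroup x (t ^ length v) W F (eval v t) ⟩
        0ℤ * F + (eval v t + x * t ^ length v) * W
          ≡⟨ cong (λ X → 0ℤ * F + X * W) (eval-snoc v x t) ⟨
        0ℤ * F + eval (v ++ x ∷ []) t * W ∎ }
    where
    open Combination (combination zero n xs)

    u≈0 : u ≈ₚ []
    u≈0 k = coeff-beyond u (subst (ℕ._≤ k) (sym length-u) z≤n)

    regroup : ∀ x T W F V → x * (T * W) + (0ℤ * F + V * W) ≡ 0ℤ * F + (V + x * T) * W
    regroup = solve-∀
  combination (suc k) n (x ∷ xs) = record
    { u = u ++ x ∷ [] ; v = v ; length-u = length-snoc u length-u ; length-v = length-v
    ; nonzero = λ { eq _ (here x≢0) → x≢0 (proj₂ (snoc-≈[] u x eq))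
                  ; eq v≈0 (there xs≢0) → nonzero (proj₁ (snoc-≈[] u x eq)) v≈0 xs≢0 }
    ; dot≡ = λ t F W c low high → begin
        x * c (k ℕ.+ n) + dot xs c
          ≡⟨ cong₂ (λ X Y → x * X + Y) (high k ℕ.≤-refl) (dot≡ t F W c low (λ i i<k → high i (ℕ.m<n⇒m<1+n i<k))) ⟩
        x * (t ^ k * F) + (eval u t * F + eval v t * W)
          ≡⟨ cong (λ m → x * (t ^ m * F) + (eval u t * F + eval v t * W)) length-u ⟨
        x * (t ^ length u * F) + (eval u t * F + eval v t * W)
          ≡⟨ regroup x (t ^ length u) F (eval u t) (eval v t * W) ⟩
        (eval u t + x * t ^ length u) * F + eval v t * W
          ≡⟨ cong (λ X → X * F + eval v t * W) (eval-snoc u x t) ⟨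
        eval (u ++ x ∷ []) t * F + eval v t * W ∎ }
    where
    open Combination (combination k n xs)

    regroup : ∀ x T F U Y → x * (T * F) + (U * F + Y) ≡ (U + x * T) * F + Y
    regroup = solve-∀

  -- The Sylvester matrix of polynomials of degrees `e + 1` and `e`.

  module Sylvester (e : ℕ) (f g : Poly) (len-f : length f ℕ.≤ suc (suc e)) (len-g : length g ℕ.≤ suc e) where

    N : ℕ
    N = suc e ℕ.+ e

    entry : ℕ → ℕ → ℤ
    entry r j = if does (r ℕ.<? e) then band (suc e) f r j else band e g (r ℕ.∸ e) j

    column : ℕ → Column
    column j i = entry (N ℕ.∸ suc i) j

    tabulate≡applyUpTo : ∀ n (c : ℕ → Column) → tabulate {n = n} (c ∘ toℕ) ≡ applyUpTo c n
    tabulate≡applyUpTo zero    c = refl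
    tabulate≡applyUpTo (suc n) c = cong (c 0 ∷_) (tabulate≡applyUpTo n (c ∘ suc))

    resultant≡D : resultant (suc e) e f g ≡ D N (applyUpTo column N)
    resultant≡D = trans
      (det≡D N (column ∘ toℕ) (λ r c → cong (λ i → entry i (toℕ c)) (sym (ℕ.m∸[m∸n]≡n (ℕ.s≤s⁻¹ (toℕ<n r))))))
      (cong (D N) (tabulate≡applyUpTo N column))

    -- Counted from the bottom, row `i` of the lower block has shift `e - i` and ends in `i` zeros,
    -- whence the power `t ^ i`. In the upper block, row `k` from its bottom has shift `e - (k + 1)`
    -- and ends in `k` zeros.
    row-g : ∀ t i → i ℕ.< suc e → horner t (λ j → column j i) N ≡ t ^ i * eval g t
    row-g t i (s≤s i≤e) = begin
      horner t (entry (e ℕ.+ e ℕ.∸ i)) N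
        ≡⟨ cong (λ r → horner t (entry r) N) (ℕ.+-∸-assoc e i≤e) ⟩
      horner t (entry (e ℕ.+ (e ℕ.∸ i))) N
        ≡⟨ horner-cong t N lower ⟩
      horner t (band e g (e ℕ.∸ i)) N
        ≡⟨ cong (horner t (band e g (e ℕ.∸ i))) N≡ ⟩
      horner t (band e g (e ℕ.∸ i)) ((e ℕ.∸ i) ℕ.+ (suc e ℕ.+ i))
        ≡⟨ horner-band e g (e ℕ.∸ i) t len-g i ⟩
      t ^ i * eval g t ∎
      where
      lower : ∀ j → entry (e ℕ.+ (e ℕ.∸ i)) j ≡ band e g (e ℕ.∸ i) j
      lower j rewrite dec-false (e ℕ.+ (e ℕ.∸ i) ℕ.<? e) (ℕ.≤⇒≯ (ℕ.m≤m+n e (e ℕ.∸ i))) | ℕ.m+n∸m≡n e (e ℕ.∸ i) = refl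

      regroup : ∀ e r i → suc e ℕ.+ (r ℕ.+ i) ≡ r ℕ.+ (suc e ℕ.+ i)
      regroup = ℕ-Solver.solve-∀

      N≡ : N ≡ (e ℕ.∸ i) ℕ.+ (suc e ℕ.+ i)
      N≡ = trans (cong (suc e ℕ.+_) (sym (ℕ.m∸n+n≡m i≤e))) (regroup e (e ℕ.∸ i) i)

    row-f : ∀ t k → k ℕ.< e → horner t (λ j → column j (k ℕ.+ suc e)) N ≡ t ^ k * eval f t
    row-f t k k<e = begin
      horner t (entry (e ℕ.+ e ℕ.∸ (k ℕ.+ suc e))) N
        ≡⟨ cong (λ r → horner t (entry r) N) r≡ ⟩
      horner t (entry r) N
        ≡⟨ horner-cong t N upper ⟩
      horner t (band (suc e) f r) N
        ≡⟨ cong (horner t (band (suc e) f r)) N≡ ⟩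
      horner t (band (suc e) f r) (r ℕ.+ (suc (suc e) ℕ.+ k))
        ≡⟨ horner-band (suc e) f r t len-f k ⟩
      t ^ k * eval f t ∎
      where
      r : ℕ
      r = e ℕ.∸ suc k

      r≡ : e ℕ.+ e ℕ.∸ (k ℕ.+ suc e) ≡ r
      r≡ = trans (cong (e ℕ.+ e ℕ.∸_) (exchange k e)) (ℕ.[m+n]∸[m+o]≡n∸o e e (suc k))
        where
        exchange : ∀ k e → k ℕ.+ suc e ≡ e ℕ.+ suc k
        exchange = ℕ-Solver.solve-∀

      upper : ∀ j → entry r j ≡ band (suc e) f r j
      upper j rewrite dec-true (r ℕ.<? e) (ℕ.∸-monoʳ-< {e} {suc k} {0} (s≤s z≤n) k<e) = refl

      regroup : ∀ e r k → suc e ℕ.+ (r ℕ.+ suc k) ≡ r ℕ.+ (suc (suc e) ℕ.+ k)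
      regroup = ℕ-Solver.solve-∀

      N≡ : N ≡ r ℕ.+ (suc (suc e) ℕ.+ k)
      N≡ = trans (cong (suc e ℕ.+_) (sym (ℕ.m∸n+n≡m k<e))) (regroup e r k)

    size : N ≡ e ℕ.+ suc e
    size = ℕ.+-comm (suc e) e

    -- A row vector that kills every column also kills their Horner sum, whatever `t` is. The
    -- entries of that sum are powers of `t` times `f(t)` or `g(t)`, so the kernel vector lists the
    -- coefficients of `u` and `v`.
    resultant-singular : resultant (suc e) e f g ≡ 0ℤ → ∃₂ λ u v → length v ≡ suc e ×
      (u ≈ₚ [] → ¬ (v ≈ₚ [])) × (∀ t → eval u t * eval f t + eval v t * eval g t ≡ 0ℤ)
    resultant-singular res≡0
      with x , x≢0 , kills ← singular⇒kernel (e ℕ.+ suc e) (applyUpTo column N)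
        (trans (length-applyUpTo column N) size) (subst (λ n → D n (applyUpTo column N) ≡ 0ℤ) size (trans (sym resultant≡D) res≡0))
      = u , v , length-v , (λ u≈0 v≈0 → nonzero u≈0 v≈0 x≢0) , λ t → begin
        eval u t * eval f t + eval v t * eval g t
          ≡⟨ dot≡ t (eval f t) (eval g t) (λ i → horner t (λ j → column j i) N) (row-g t) (row-f t) ⟨
        dot x (λ i → horner t (λ j → column j i) N)
          ≡⟨ dot-horner t x column N ⟩
        horner t (λ j → dot x (column j)) N
          ≡⟨ horner-0 t (λ j → dot x (column j)) N (λ j j<N → applyUpTo⁻ column N kills j<N) ⟩
        0ℤ ∎
      where
      open Combination (combination e (suc e) x)

    row-divisible : ∀ {b} t → b ∣ eval f t → b ∣ eval g t → ∀ i → i ℕ.< N → b ∣ horner t (λ j → column j i) N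
    row-divisible {b} t b∣f b∣g i i<N with i ℕ.<? suc e
    ... | yes i≤e = subst (b ∣_) (sym (row-g t i i≤e)) (∣n⇒∣m*n (t ^ i) b∣g)
    ... | no  i≰e = subst (b ∣_) (sym (trans (cong (λ i → horner t (λ j → column j i) N) (sym i≡)) (row-f t k k<e)))
                      (∣n⇒∣m*n (t ^ k) b∣f)
      where
      k : ℕ
      k = i ℕ.∸ suc e

      i≡ : k ℕ.+ suc e ≡ i
      i≡ = ℕ.m∸n+n≡m (ℕ.≮⇒≥ i≰e)

      k<e : k ℕ.< e
      k<e = ℕ.+-cancelʳ-< (suc e) k e (subst₂ ℕ._<_ (sym i≡) size i<N)

    module _ {a : ℤ} (a∣f : a ∣ coeff f (suc e)) (a∣g : a ∣ coeff g e) where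

      a∣column₀ : ∀ i → i ℕ.< N → a ∣ column 0 i
      a∣column₀ i _ with does (N ℕ.∸ suc i ℕ.<? e)
      ... | true  = band-first (suc e) f (N ℕ.∸ suc i) a∣f
      ... | false = band-first e g (N ℕ.∸ suc i ℕ.∸ e) a∣g

      leading∣resultant : a ∣ resultant (suc e) e f g
      leading∣resultant =
        let u , pull = D-divides-column N a (column 0) a∣column₀
        in divides (D N (u ∷ applyUpTo (column ∘ suc) (e ℕ.+ e)))
             (trans resultant≡D (trans (pull [] (applyUpTo (column ∘ suc) (e ℕ.+ e))) (*-comm a _)))

      common-root∣resultant : ∀ {b} t → 1 ℕ.≤ e → b ∣ eval f t → b ∣ eval g t → ∃ λ K → resultant (suc e) e f g ≡ a * (b * K)
      -- Since `e` is positive, there are at least two columns.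
      common-root∣resultant t (s≤s {n = e′} _) b∣f b∣g =
        let K , eq = D-divides-first-last N t column (e′ ℕ.+ suc e′) a∣column₀ (row-divisible t b∣f b∣g)
        in K , trans resultant≡D eq

  -- The derivative and the discriminant.

  coeff-derivAux : ∀ k as i → coeff (derivAux k as) i ≡ + (k ℕ.+ i) * coeff as i
  coeff-derivAux k []       i       = sym (*-zeroʳ (+ (k ℕ.+ i)))
  coeff-derivAux k (a ∷ as) zero    = cong (λ n → + n * a) (sym (ℕ.+-identityʳ k))
  coeff-derivAux k (a ∷ as) (suc i) =
    trans (coeff-derivAux (suc k) as i) (cong (λ n → + n * coeff as i) (sym (ℕ.+-suc k i)))

  coeff-deriv : ∀ f i → coeff (deriv f) i ≡ + suc i * coeff f (suc i)
  coeff-deriv []       i = sym (*-zeroʳ (+ suc i))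
  coeff-deriv (_ ∷ as) i = coeff-derivAux 1 as i

  length-deriv : ∀ f {d} → length f ≡ suc d → length (deriv f) ≡ d
  length-deriv (_ ∷ as) refl = length-derivAux 1 as
    where
    length-derivAux : ∀ k as → length (derivAux k as) ≡ length as
    length-derivAux k []       = refl
    length-derivAux k (_ ∷ as) = cong suc (length-derivAux (suc k) as)

  -- The remainder equals `∣ a ∣` times `∣ X - q ∣` and is smaller than `∣ a ∣`, so `X - q`
  -- vanishes; this treats both signs of `a` alike.
  *-/-cancel : ∀ a X .{{_ : NonZero a}} → (a * X) / a ≡ X
  *-/-cancel a X = sym (i-j≡0⇒i≡j X q (∣i∣≡0⇒i≡0 (abs-zero ∣ X - q ∣ (begin
    ∣ a ∣ ℕ.* ∣ X - q ∣                  ≡⟨ abs-* a (X - q) ⟨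
    ∣ a * (X - q) ∣                      ≡⟨ cong ∣_∣ (expand-product a X q) ⟩
    ∣ a * X - q * a ∣                    ≡⟨ cong (λ Y → ∣ Y - q * a ∣) (a≡a%n+[a/n]*n (a * X) a) ⟩
    ∣ + ((a * X) % a) + q * a - q * a ∣  ≡⟨ cong ∣_∣ (drop-last (+ ((a * X) % a)) (q * a)) ⟩
    (a * X) % a ∎))))
    where
    q : ℤ
    q = (a * X) / a

    expand-product : ∀ a X q → a * (X - q) ≡ a * X - q * a
    expand-product = solve-∀

    drop-last : ∀ r y → r + y - y ≡ r
    drop-last = solve-∀

    abs-zero : ∀ m → ∣ a ∣ ℕ.* m ≡ (a * X) % a → m ≡ 0
    abs-zero zero    _  = refl
    abs-zero (suc m) eq = contradiction
      (ℕ.≤-trans (ℕ.m≤m*n ∣ a ∣ (suc m)) (ℕ.≤-reflexive eq)) (ℕ.<⇒≱ (n%d<d (a * X) a))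

  exactDiv-* : ∀ a X → a ≢ 0ℤ → exactDiv (a * X) a ≡ X
  exactDiv-* (+ zero)   X a≢0 = contradiction refl a≢0
  exactDiv-* (+[1+ n ]) X a≢0 = *-/-cancel +[1+ n ] X
  exactDiv-* (-[1+ n ]) X a≢0 = *-/-cancel -[1+ n ] X

  ∣altSign∣≡1 : ∀ k → ∣ altSign k ∣ ≡ 1
  ∣altSign∣≡1 zero          = refl
  ∣altSign∣≡1 (suc zero)    = refl
  ∣altSign∣≡1 (suc (suc k)) = ∣altSign∣≡1 k

  -- `disc` with `deg f` replaced by a variable, along which the length hypothesis can be
  -- substituted.
  discOfDegree : ℕ → Poly → ℤ
  discOfDegree n f = altSign ((n ℕ.* (n ℕ.∸ 1)) ℕ./ 2) * exactDiv (resultant n (n ℕ.∸ 1) f (deriv f)) (coeff f n)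

  ∣altSign*exactDiv∣ : ∀ s {r a} X → a ≢ 0ℤ → r ≡ a * X → ∣ altSign s * exactDiv r a ∣ ≡ ∣ X ∣
  ∣altSign*exactDiv∣ s {a = a} X a≢0 refl = begin
    ∣ altSign s * exactDiv (a * X) a ∣   ≡⟨ cong (λ Y → ∣ altSign s * Y ∣) (exactDiv-* a X a≢0) ⟩
    ∣ altSign s * X ∣                    ≡⟨ abs-* (altSign s) X ⟩
    ∣ altSign s ∣ ℕ.* ∣ X ∣              ≡⟨ cong (ℕ._* ∣ X ∣) (∣altSign∣≡1 s) ⟩
    1 ℕ.* ∣ X ∣                          ≡⟨ ℕ.*-identityˡ ∣ X ∣ ⟩
    ∣ X ∣ ∎

  ∣disc∣ : ∀ {e} f X → length f ≡ suc (suc e) → coeff f (suc e) ≢ 0ℤ →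
    resultant (suc e) e f (deriv f) ≡ coeff f (suc e) * X → ∣ disc f ∣ ≡ ∣ X ∣
  ∣disc∣ {e} f X len lead≢0 res = trans
    (cong (λ n → ∣ discOfDegree n f ∣) (cong (ℕ._∸ 1) len))
    (∣altSign*exactDiv∣ ((suc e ℕ.* e) ℕ./ 2) X lead≢0 res)

  module _ {e} (f : Poly) (len : length f ≡ suc (suc e)) (lead≢0 : coeff f (suc e) ≢ 0ℤ) where
    open Sylvester e f (deriv f) (ℕ.≤-reflexive len) (ℕ.≤-reflexive (length-deriv f len))

    leading∣deriv : coeff f (suc e) ∣ coeff (deriv f) e
    leading∣deriv = divides (+ suc e) (coeff-deriv f e)

    double-root∣disc : ∀ {p} t → 1 ℕ.≤ e → + p ∣ eval f t → + p ∣ eval (deriv f) t → p ℕ.∣ ∣ disc f ∣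
    double-root∣disc {p} t 1≤e p∣f p∣f′
      with K , res ← common-root∣resultant ∣-refl leading∣deriv t 1≤e p∣f p∣f′ =
      ℕ.divides ∣ K ∣ (trans (∣disc∣ f (+ p * K) len lead≢0 res) (trans (abs-* (+ p) K) (ℕ.*-comm p ∣ K ∣)))

    -- For `v = 0` also `u f = 0`, forcing `u = 0`. Otherwise `f` divides `v f′`, a product of
    -- nonzero polynomials of smaller degree, against irreducibility; `f′` is nonzero because its
    -- leading coefficient is `e + 1` times that of `f`.
    no-short-relation : Irreducible f → ∀ u v → length v ≡ suc e → (u ≈ₚ [] → ¬ (v ≈ₚ [])) →
      ¬ (∀ t → eval u t * eval f t + eval v t * eval (deriv f) t ≡ 0ℤ)
    no-short-relation irr u v len-v nonzero relation with trim v
    ... | inj₁ v≈0 = nonzero u≈0 v≈0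
      where
      u≈0 : u ≈ₚ []
      u≈0 = short-multiple [] u (hasDegree f (suc e) len lead≢0) z≤n (λ t → sym (begin
        eval u t * eval f t
          ≡⟨ +-identityʳ _ ⟨
        eval u t * eval f t + 0ℤ * eval (deriv f) t
          ≡⟨ cong (λ Y → eval u t * eval f t + Y * eval (deriv f) t) (eval-≈[] v v≈0 t) ⟨
        eval u t * eval f t + eval v t * eval (deriv f) t
          ≡⟨ relation t ⟩
        0ℤ ∎))
    ... | inj₂ (v′ , n , hv′ , n<l , v≈v′) =
      irreducible∤product (deriv f) irr (hasDegree f (suc e) len lead≢0)
        (ℕ.≤-reflexive (length-deriv f len)) deriv≉0 (suc n) (scale -1ℤ u) hv′ ℕ.≤-refl (subst (n ℕ.<_) len-v n<l) (λ t → begin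
          eval v′ t * eval (deriv f) t
            ≡⟨ cong (λ Y → Y * eval (deriv f) t) (eval-cong v v′ v≈v′ t) ⟨
          eval v t * eval (deriv f) t
            ≡⟨ isolate (eval u t * eval f t) (eval v t * eval (deriv f) t) ⟩
          eval u t * eval f t + eval v t * eval (deriv f) t - eval u t * eval f t
            ≡⟨ cong (λ Y → Y - eval u t * eval f t) (relation t) ⟩
          0ℤ - eval u t * eval f t
            ≡⟨ negate (eval u t) (eval f t) ⟩
          -1ℤ * eval u t * eval f t
            ≡⟨ cong (λ Y → Y * eval f t) (eval-scale -1ℤ u t) ⟨
          eval (scale -1ℤ u) t * eval f t ∎)
      where
      isolate : ∀ A B → B ≡ A + B - A
      isolate = solve-∀

      negate : ∀ U F → 0ℤ - U * F ≡ -1ℤ * U * F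
      negate = solve-∀

      deriv≉0 : ¬ (deriv f ≈ₚ [])
      deriv≉0 f′≈0 = lead≢0 (*-cancel-0 {+ suc e} (λ ()) (trans (sym (coeff-deriv f e)) (f′≈0 e)))

    resultant≢0 : Irreducible f → resultant (suc e) e f (deriv f) ≢ 0ℤ
    resultant≢0 irr res≡0 =
      let u , v , len-v , nonzero , relation = resultant-singular res≡0
      in no-short-relation irr u v len-v nonzero relation

    disc≢0 : Irreducible f → ∣ disc f ∣ ≢ 0
    disc≢0 irr disc≡0 = resultant≢0 irr (vanish (leading∣resultant ∣-refl leading∣deriv))
      where
      vanish : coeff f (suc e) ∣ resultant (suc e) e f (deriv f) → resultant (suc e) e f (deriv f) ≡ 0ℤ
      vanish (divides X res≡) = trans res≡ (cong (λ Y → Y * coeff f (suc e)) (∣i∣≡0⇒i≡0 {X}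
        (trans (sym (∣disc∣ f X len lead≢0 (trans res≡ (*-comm X (coeff f (suc e)))))) disc≡0)))

-- Primes modulo which `f` has a simple root, and their size.

module SimpleRoots where
  open Polynomials
  open Discriminants using (disc≢0; double-root∣disc)
  open import Data.Nat.ListAction.Properties using (product≢0; ∈⇒∣product)
  open import Data.Nat.Primality using (prime?; prime[2]; ¬prime[1]; prime⇒nonZero)
  open import Data.Nat.Primality.Factorisation using (factorise)
  open import Data.Integer using (+_; -[1+_]; 1ℤ; -1ℤ; _+_; _*_; _⊖_; _≟_; ≢-nonZero)
  open import Data.Integer.Properties using (abs-*; ∣i+j∣≤∣i∣+∣j∣; ∣i∣≡0⇒i≡0; ∣⊖∣-≤; ∣m⊖n∣≡∣n⊖m∣; ⊖-monoˡ-<; <⇒≢)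
  open import Data.Integer.Properties using (+-injective; *-cancelʳ-≡; *-cancelˡ-≡; *-zeroʳ; +-identityʳ)
  open import Data.Integer.Divisibility.Signed using (_∣_; ∣ᵤ⇒∣; ∣⇒∣ᵤ; ∣m+n∣n⇒∣m; ∣m⇒∣m*n; ∣n⇒∣m*n)
  open import Data.List using (upTo)
  open import Data.List.Membership.Propositional.Properties using (∈-filter⁺; ∈-upTo⁺)
  open import Data.List.Relation.Unary.All.Properties using (all-filter; ¬All⇒Any¬)
  open import Data.List.Relation.Unary.Any.Properties using (applyUpTo⁻)
  open import Relation.Nullary.Decidable using (_×-dec_; _⊎-dec_)

  prime∣⇒∣radical : ∀ {p n} → Prime p → n ≢ 0 → p ℕ.∣ n → p ℕ.∣ radical n
  prime∣⇒∣radical {p} {n} pr n≢0 p∣n = ∈⇒∣product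
    (∈-filter⁺ (λ q → prime? q ×-dec (q ℕ.∣? n)) (∈-upTo⁺ (s≤s (ℕ.∣⇒≤ {{ℕ.≢-nonZero n≢0}} p∣n))) (pr , p∣n))

  radical-nonZero : ∀ n → ℕ.NonZero (radical n)
  radical-nonZero n = product≢0
    (All.map (prime⇒nonZero ∘ proj₁) (all-filter (λ q → prime? q ×-dec (q ℕ.∣? n)) (upTo (suc n))))

  prime-divisor : ∀ {n} → 2 ℕ.≤ n → ∃ λ p → Prime p × p ℕ.∣ n × p ℕ.≤ n
  prime-divisor {suc n} 2≤n with factorise (suc n)
  ... | record { factors = []     ; isFactorisation = refl } = contradiction 2≤n (ℕ.<⇒≱ (s≤s (s≤s z≤n)))
  ... | record { factors = p ∷ ps ; isFactorisation = eq ; factorsPrime = pr ∷ _ } =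
    p , pr , p∣n , ℕ.∣⇒≤ p∣n
    where
    p∣n : p ℕ.∣ suc n
    p∣n = subst (p ℕ.∣_) (sym eq) (ℕ.m∣m*n _)

  prime∤1 : ∀ {p} → Prime p → ¬ (p ℕ.∣ 1)
  prime∤1 pr p∣1 = ¬prime[1] (subst Prime (ℕ.∣1⇒≡1 p∣1) pr)

  ∣constant∣≤height : ∀ f → ∣ coeff f 0 ∣ ℕ.≤ height f
  ∣constant∣≤height []      = z≤n
  ∣constant∣≤height (a ∷ f) = ℕ.m≤m⊔n ∣ a ∣ (height f)

  -- The summand `H` on the left strengthens the induction: a step produces `2 H` beside `Y` times
  -- the previous value, and `2 ≤ Y` turns it into `Y H`. This replaces the summation of a geometric
  -- series and is the origin of the factor 2.
  ∣eval∣-bound : ∀ f {n H Y} y → length f ≡ suc n → height f ℕ.≤ H → 2 ℕ.≤ Y → ∣ y ∣ ℕ.≤ Y →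
    ∣ eval f y ∣ ℕ.+ H ℕ.≤ 2 ℕ.* H ℕ.* Y ℕ.^ n
  ∣eval∣-bound (a ∷ []) {zero} {H} y _ ht _ _ = begin
    ∣ a + y * 0ℤ ∣ ℕ.+ H   ≡⟨ cong (λ X → ∣ X ∣ ℕ.+ H) (trans (cong (λ X → a + X) (*-zeroʳ y)) (+-identityʳ a)) ⟩
    ∣ a ∣ ℕ.+ H            ≤⟨ ℕ.+-monoˡ-≤ H (ℕ.≤-trans (ℕ.m≤m⊔n ∣ a ∣ 0) ht) ⟩
    H ℕ.+ H                ≡⟨ double H ⟩
    2 ℕ.* H ℕ.* 1 ∎
    where
    open ℕ.≤-Reasoning
    double : ∀ H → H ℕ.+ H ≡ 2 ℕ.* H ℕ.* 1
    double = ℕ-Solver.solve-∀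
  ∣eval∣-bound (a ∷ f@(_ ∷ _)) {suc n} {H} {Y} y len ht 2≤Y y≤Y = begin
    ∣ a + y * eval f y ∣ ℕ.+ H
      ≤⟨ ℕ.+-monoˡ-≤ H (∣i+j∣≤∣i∣+∣j∣ a (y * eval f y)) ⟩
    ∣ a ∣ ℕ.+ ∣ y * eval f y ∣ ℕ.+ H
      ≡⟨ cong (λ X → ∣ a ∣ ℕ.+ X ℕ.+ H) (abs-* y (eval f y)) ⟩
    ∣ a ∣ ℕ.+ ∣ y ∣ ℕ.* ∣ eval f y ∣ ℕ.+ H
      ≤⟨ ℕ.+-monoˡ-≤ H (ℕ.+-mono-≤ (ℕ.≤-trans (ℕ.m≤m⊔n ∣ a ∣ (height f)) ht) (ℕ.*-monoˡ-≤ ∣ eval f y ∣ y≤Y)) ⟩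
    H ℕ.+ Y ℕ.* ∣ eval f y ∣ ℕ.+ H
      ≡⟨ collect H (Y ℕ.* ∣ eval f y ∣) ⟩
    Y ℕ.* ∣ eval f y ∣ ℕ.+ 2 ℕ.* H
      ≤⟨ ℕ.+-monoʳ-≤ (Y ℕ.* ∣ eval f y ∣) (ℕ.*-monoˡ-≤ H 2≤Y) ⟩
    Y ℕ.* ∣ eval f y ∣ ℕ.+ Y ℕ.* H
      ≡⟨ ℕ.*-distribˡ-+ Y ∣ eval f y ∣ H ⟨
    Y ℕ.* (∣ eval f y ∣ ℕ.+ H)
      ≤⟨ ℕ.*-monoʳ-≤ Y (∣eval∣-bound f y (ℕ.suc-injective len) (ℕ.≤-trans (ℕ.m≤n⊔m ∣ a ∣ (height f)) ht) 2≤Y y≤Y) ⟩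
    Y ℕ.* (2 ℕ.* H ℕ.* Y ℕ.^ n)
      ≡⟨ exchange Y H (Y ℕ.^ n) ⟩
    2 ℕ.* H ℕ.* (Y ℕ.* Y ℕ.^ n) ∎
    where
    open ℕ.≤-Reasoning
    collect : ∀ H X → H ℕ.+ X ℕ.+ H ≡ X ℕ.+ 2 ℕ.* H
    collect = ℕ-Solver.solve-∀

    exchange : ∀ Y H P → Y ℕ.* (2 ℕ.* H ℕ.* P) ≡ 2 ℕ.* H ℕ.* (Y ℕ.* P)
    exchange = ℕ-Solver.solve-∀

  -- If the constant term vanishes, then `f = X h`, and neither `X` nor `h`, of degree `d - 1 ≥ 1`,
  -- is a unit.
  constant≢0 : ∀ {d} f → 2 ℕ.≤ d → coeff f d ≢ 0ℤ → Irreducible f → coeff f 0 ≢ 0ℤ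
  constant≢0 []      _ _ (f≉0 , _) _ = f≉0 (λ _ → refl)
  constant≢0 {suc (suc d)} (a ∷ h) (s≤s (s≤s _)) lead≢0 (_ , _ , irr) refl
    with irr (0ℤ ∷ 1ℤ ∷ []) h (eval-injective (0ℤ ∷ h) ((0ℤ ∷ 1ℤ ∷ []) *ₚ h)
           (λ x → trans (regroup x (eval h x)) (sym (eval-*ₚ (0ℤ ∷ 1ℤ ∷ []) h x))))
    where
    regroup : ∀ x H → 0ℤ + x * H ≡ (0ℤ + x * (1ℤ + x * 0ℤ)) * H
    regroup = solve-∀
  ... | inj₁ unit = contradiction (proj₂ (unit-constant (0ℤ ∷ 1ℤ ∷ []) unit) 1) (λ ())
  ... | inj₂ unit = lead≢0 (proj₂ (unit-constant h unit) (suc d))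

  ∣i∣≡1 : ∀ {i} → ∣ i ∣ ≡ 1 → i ≡ 1ℤ ⊎ i ≡ -1ℤ
  ∣i∣≡1 {+ 1}       _ = inj₁ refl
  ∣i∣≡1 { -[1+ 0 ]} _ = inj₂ refl

  shift-bound : ∀ {i d} → i ℕ.≤ d ℕ.+ d → ∣ i ⊖ d ∣ ℕ.≤ d
  shift-bound {i} {d} i≤2d with ℕ.≤-total i d
  ... | inj₁ i≤d = subst (ℕ._≤ d) (sym (∣⊖∣-≤ i≤d)) (ℕ.m∸n≤m d i)
  ... | inj₂ d≤i = subst (ℕ._≤ d) (sym (trans (∣m⊖n∣≡∣n⊖m∣ i d) (∣⊖∣-≤ d≤i))) (ℕ.m≤n+o⇒m∸n≤o i d i≤2d)

  -- For f = a + X h, writing f(a x) = a V with V = 1 + x h(a x), the condition V = ±1 means that a x is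
  -- a root of f − a or of f + a, so it fails for one of any 2 deg f + 1 values of x.
  ∣V∣≢1 : ∀ {e} a h m → HasDegree h e → a ≢ 0ℤ → m ≢ 0 →
    ∃ λ k → ∣ k ∣ ℕ.≤ suc e × ∣ 1ℤ + k * + m * eval h (a * (k * + m)) ∣ ≢ 1
  ∣V∣≢1 {e} a h m hh a≢0 m≢0 =
    let i , i<l , ¬root = applyUpTo⁻ point (¬All⇒Any¬ root? points
          (roots-bounded points (0ℤ ∷ hh) (a + a ∷ hh) unique (ℕ.≤-reflexive (sym (length-applyUpTo point (suc (d ℕ.+ d)))))))
    in i ⊖ d , shift-bound (ℕ.s≤s⁻¹ i<l) , ¬root ∘ root ((i ⊖ d) * + m)
    where
    d : ℕ
    d = suc e

    point : ℕ → ℤ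
    -- The multipliers `i ⊖ d` run from `- d` to `d`: one more value than the total degree `2 d`,
    -- and as small as possible.
    point i = a * ((i ⊖ d) * + m)

    points : List ℤ
    points = applyUpTo point (suc (d ℕ.+ d))

    Root : ℤ → Set
    -- For `f = a + X h` these two lists are `f - a` and `f + a`.
    Root y = eval (0ℤ ∷ h) y ≡ 0ℤ ⊎ eval (a + a ∷ h) y ≡ 0ℤ

    root? : ∀ y → Dec (Root y)
    root? y = (eval (0ℤ ∷ h) y ≟ 0ℤ) ⊎-dec (eval (a + a ∷ h) y ≟ 0ℤ)

    unique : Unique points
    unique = applyUpTo⁺₁ point (suc (d ℕ.+ d)) (λ {i} {j} i<j _ eq → <⇒≢ (⊖-monoˡ-< d i<j)
      (*-cancelʳ-≡ (i ⊖ d) (j ⊖ d) (+ m) {{≢-nonZero (m≢0 ∘ +-injective)}}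
        (*-cancelˡ-≡ a ((i ⊖ d) * + m) ((j ⊖ d) * + m) {{≢-nonZero a≢0}} eq)))

    left : ∀ a x h → 0ℤ + a * x * h ≡ a * (1ℤ + x * h) + -1ℤ * a
    left = solve-∀

    right : ∀ a x h → a + a + a * x * h ≡ a * (1ℤ + x * h) + a
    right = solve-∀

    cancel₁ : ∀ a → a * 1ℤ + -1ℤ * a ≡ 0ℤ
    cancel₁ = solve-∀

    cancel₂ : ∀ a → a * -1ℤ + a ≡ 0ℤ
    cancel₂ = solve-∀

    root : ∀ x → ∣ 1ℤ + x * eval h (a * x) ∣ ≡ 1 → Root (a * x)
    root x ∣V∣≡1 with ∣i∣≡1 ∣V∣≡1
    ... | inj₁ V≡1  = inj₁ (trans (left a x (eval h (a * x))) (trans (cong (λ V → a * V + -1ℤ * a) V≡1) (cancel₁ a)))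
    ... | inj₂ V≡-1 = inj₂ (trans (right a x (eval h (a * x))) (trans (cong (λ V → a * V + a) V≡-1) (cancel₂ a)))

  module _ {e} (f : Poly) (1≤e : 1 ℕ.≤ e) (len : length f ≡ suc (suc e)) (lead≢0 : coeff f (suc e) ≢ 0ℤ)
           (irr : Irreducible f) where

    M : ℕ
    M = radical ∣ disc f ∣

    simple-root : ∀ {p} t → Prime p → ¬ (p ℕ.∣ M) → + p ∣ eval f t → SimpleRootMod f p
    simple-root t pr p∤M p∣f = t , ∣⇒∣ᵤ p∣f , λ p∣f′ → p∤M (prime∣⇒∣radical pr (disc≢0 f len lead≢0 irr)
      (double-root∣disc f len lead≢0 t 1≤e p∣f (∣ᵤ⇒∣ p∣f′)))

    coprime-constant : gcd ∣ coeff f 0 ∣ M ≡ 1 → 2 ℕ.≤ ∣ coeff f 0 ∣ →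
      ∃ λ p → Prime p × p ℕ.≤ height f × SimpleRootMod f p
    coprime-constant gcd≡1 2≤a =
      let p , pr , p∣a , p≤a = prime-divisor 2≤a
      in p , pr , ℕ.≤-trans p≤a (∣constant∣≤height f) , simple-root 0ℤ pr
        (λ p∣M → prime∤1 pr (subst (p ℕ.∣_) gcd≡1 (gcd-greatest p∣a p∣M)))
        (∣ᵤ⇒∣ (subst (λ a → p ℕ.∣ ∣ a ∣) (sym (eval-0 f)) p∣a))
      where
      eval-0 : ∀ f → eval f 0ℤ ≡ coeff f 0
      eval-0 []      = refl
      eval-0 (a ∷ f) = +-identityʳ a

  -- Keeping `∣ a₀ ∣` in the bound serves two cases at once: it disappears when `∣ a₀ ∣ = 1`, and is
  -- at most the height otherwise.
  nonzero-constant : ∀ {e} f → 1 ℕ.≤ e → length f ≡ suc (suc e) → coeff f (suc e) ≢ 0ℤ → Irreducible f →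
    coeff f 0 ≢ 0ℤ → ∃ λ p → Prime p ×
      p ℕ.≤ 2 ℕ.* height f ℕ.* (suc e ℕ.* ∣ coeff f 0 ∣ ℕ.* radical ∣ disc f ∣) ℕ.^ suc e × SimpleRootMod f p
  nonzero-constant {e} f@(a ∷ h) 1≤e len lead≢0 irr a≢0 = conclude (∣ V ∣ ℕ.≟ 0)
    where
    d = suc e
    m = radical ∣ disc f ∣
    H = height f

    m≢0 : m ≢ 0
    m≢0 = ℕ.≢-nonZero⁻¹ m {{radical-nonZero ∣ disc f ∣}}

    chosen : ∃ λ k → ∣ k ∣ ℕ.≤ d × ∣ 1ℤ + k * + m * eval h (a * (k * + m)) ∣ ≢ 1
    chosen = ∣V∣≢1 a h m (hasDegree h e (ℕ.suc-injective len) lead≢0) a≢0 m≢0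

    k = proj₁ chosen
    x = k * + m
    y = a * x
    V = 1ℤ + x * eval h y
    Y = d ℕ.* ∣ a ∣ ℕ.* m
    B = 2 ℕ.* H ℕ.* Y ℕ.^ d

    f[y]≡aV : eval f y ≡ a * V
    f[y]≡aV = factor a x (eval h y)
      where
      factor : ∀ a x h → a + a * x * h ≡ a * (1ℤ + x * h)
      factor = solve-∀

    1≤∣a∣ : 1 ℕ.≤ ∣ a ∣
    1≤∣a∣ = ℕ.n≢0⇒n>0 (a≢0 ∘ ∣i∣≡0⇒i≡0)

    2≤Y : 2 ℕ.≤ Y
    2≤Y = ℕ.*-mono-≤ (ℕ.*-mono-≤ (s≤s 1≤e) 1≤∣a∣) (ℕ.n≢0⇒n>0 m≢0)

    ∣y∣≤Y : ∣ y ∣ ℕ.≤ Y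
    ∣y∣≤Y = begin
      ∣ a * (k * + m) ∣          ≡⟨ trans (abs-* a (k * + m)) (cong (∣ a ∣ ℕ.*_) (abs-* k (+ m))) ⟩
      ∣ a ∣ ℕ.* (∣ k ∣ ℕ.* m)    ≤⟨ ℕ.*-monoʳ-≤ ∣ a ∣ (ℕ.*-monoˡ-≤ m (proj₁ (proj₂ chosen))) ⟩
      ∣ a ∣ ℕ.* (d ℕ.* m)        ≡⟨ exchange ∣ a ∣ d m ⟩
      d ℕ.* ∣ a ∣ ℕ.* m ∎
      where
      open ℕ.≤-Reasoning
      exchange : ∀ a d m → a ℕ.* (d ℕ.* m) ≡ d ℕ.* a ℕ.* m
      exchange = ℕ-Solver.solve-∀

    bound : ∣ eval f y ∣ ℕ.+ H ℕ.≤ B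
    bound = ∣eval∣-bound f y len ℕ.≤-refl 2≤Y ∣y∣≤Y

    ∣V∣≤B : ∣ V ∣ ℕ.≤ B
    ∣V∣≤B = begin
      ∣ V ∣                 ≤⟨ ℕ.m≤n*m ∣ V ∣ ∣ a ∣ {{ℕ.>-nonZero 1≤∣a∣}} ⟩
      ∣ a ∣ ℕ.* ∣ V ∣       ≡⟨ abs-* a V ⟨
      ∣ a * V ∣             ≡⟨ cong ∣_∣ f[y]≡aV ⟨
      ∣ eval f y ∣          ≤⟨ ℕ.m≤m+n ∣ eval f y ∣ H ⟩
      ∣ eval f y ∣ ℕ.+ H    ≤⟨ bound ⟩
      B ∎
      where open ℕ.≤-Reasoning

    -- Needed for `V = 0`, where the prime 2 is taken and must respect the bound.
    2≤B : 2 ℕ.≤ B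
    2≤B = ℕ.*-mono-≤ (ℕ.*-monoʳ-≤ 2 (ℕ.≤-trans 1≤∣a∣ (∣constant∣≤height f)))
      (ℕ.m^n>0 Y {{ℕ.>-nonZero (ℕ.≤-trans (s≤s z≤n) 2≤Y)}} d)

    p∤m : ∀ {p} → Prime p → + p ∣ V → ¬ (p ℕ.∣ m)
    p∤m pr p∣V p∣m = prime∤1 pr (∣⇒∣ᵤ (∣m+n∣n⇒∣m {m = 1ℤ} p∣V (∣m⇒∣m*n (eval h y) (∣n⇒∣m*n k (∣ᵤ⇒∣ p∣m)))))

    finish : ∀ {p} → Prime p → p ℕ.≤ B → + p ∣ V → ∃ λ p → Prime p × p ℕ.≤ B × SimpleRootMod f p
    finish {p} pr p≤B p∣V = p , pr , p≤B ,
      simple-root f 1≤e len lead≢0 irr y pr (p∤m pr p∣V) (subst (+ p ∣_) (sym f[y]≡aV) (∣n⇒∣m*n a p∣V))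

    -- If V = 0 then m = 1, and every prime works.
    conclude : Dec (∣ V ∣ ≡ 0) → ∃ λ p → Prime p × p ℕ.≤ B × SimpleRootMod f p
    conclude (yes V≡0) = finish prime[2] 2≤B (∣ᵤ⇒∣ (subst (2 ℕ.∣_) (sym V≡0) (2 ℕ.∣0)))
    conclude (no V≢0)  =
      let p , pr , p∣V , p≤V = prime-divisor (ℕ.≤∧≢⇒< (ℕ.n≢0⇒n>0 V≢0) (proj₂ (proj₂ chosen) ∘ sym))
      in finish pr (ℕ.≤-trans p≤V ∣V∣≤B) (∣ᵤ⇒∣ p∣V)

open SimpleRoots using (coprime-constant; nonzero-constant; constant≢0; ∣constant∣≤height)
open import Data.Nat using (_≤_; _<_; _*_; _^_)

theorem4p1 : (d : ℕ) (f : Poly) → 2 ≤ d → length f ≡ suc d → coeff f d ≢ 0ℤ →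
    Irreducible f →
    ((gcd ∣ coeff f 0 ∣ (radical ∣ disc f ∣) ≡ 1 → 1 < ∣ coeff f 0 ∣ →
    ∃ λ p → Prime p × p ≤ height f × SimpleRootMod f p)
    × (∣ coeff f 0 ∣ ≡ 1 →
    ∃ λ p → Prime p × p ≤ 2 * height f * (d * radical ∣ disc f ∣) ^ d × SimpleRootMod f p)
    × (1 < gcd ∣ coeff f 0 ∣ (radical ∣ disc f ∣) →
    ∃ λ p → Prime p × p ≤ 2 * height f * (d * height f * radical ∣ disc f ∣) ^ d
    × SimpleRootMod f p))
theorem4p1 (suc e) f (s≤s 1≤e) len lead≢0 irr =
    coprime-constant f 1≤e len lead≢0 irr
  , (λ ∣a₀∣≡1 →
      let p , pr , p≤ , root = nonzero-constant f 1≤e len lead≢0 irr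
            (λ a₀≡0 → ℕ.0≢1+n (trans (sym (cong ∣_∣ a₀≡0)) ∣a₀∣≡1))
      in p , pr , subst (λ k → p ≤ 2 * height f * (k * radical ∣ disc f ∣) ^ suc e)
           (trans (cong (suc e *_) ∣a₀∣≡1) (ℕ.*-identityʳ (suc e))) p≤ , root)
  , (λ _ →
      let p , pr , p≤ , root = nonzero-constant f 1≤e len lead≢0 irr
            (constant≢0 f (s≤s 1≤e) lead≢0 irr)
      in p , pr , ℕ.≤-trans p≤ (ℕ.*-monoʳ-≤ (2 * height f) (ℕ.^-monoˡ-≤ (suc e)
           (ℕ.*-monoˡ-≤ (radical ∣ disc f ∣) (ℕ.*-monoʳ-≤ (suc e) (∣constant∣≤height f))))) , root)
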